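{- Let $\Delta\ge 4$ and let $T$ be a tree of order $n$ with maximum degree $\Delta$. For $1\le i\le\Delta$ let $n_i$ be the number of vertices of degree $i$ in $T$, and for $1\le i\le j\le\Delta$ let $m_{i,j}$ be the number of edges of $T$ joining a vertex of degree $i$ to a vertex of degree $j$. Define \[ F(i,j)=(4\Delta-6)\Bigl(\frac{1}{i}+\frac{1}{j}\Bigr)+\Delta^2-6\Delta+3+\frac{6}{\Delta}-(i-j)^2, \qquad P(T)=\sum_{1\le i\le j\le \Delta} F(i,j)\,m_{i,j}. \] If $\Delta$ divides $n$, then $P(T)\ge F(\Delta,\Delta)$. Moreover, equality holds if and only if \[ m_{\Delta,\Delta}=1,\quad m_{1,\Delta}>0,\quad m_{2,\Delta}>0,\quad m_{i,j}=0 \text{ for all other } (i,j), \] in which case \[ n_\Delta=\frac{n}{\Delta},\quad n_2=\frac{n}{\Delta}-2,\quad n_1=(\Delta-2)\frac{n}{\Delta}+2,\quad m_{1,\Delta}=n_1,\quad m_{2,\Delta}=2n_2,\quad m_{\Delta,\Delta}=1 . \]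
   Context: For every tree $T$ of order $n$ and maximum degree $\Delta$ one has $\sigma(T)=\lambda n+\mu(n-1)-P(T)$ with $\lambda=4\Delta-6$, $\mu=\Delta^2-6\Delta+3+6/\Delta$, where $\sigma(T)=\sum_{uv\in E(T)}(d(u)-d(v))^2$; so minimizing $P(T)$ is equivalent to maximizing $\sigma(T)$.
   Formalization: In the equality condition, m_{2,Δ}>0 is required only when n≠2Δ: for n=2Δ the double star (two adjacent vertices of degree Δ, all others leaves) has P(T)=F(Δ,Δ) but m_{2,Δ}=0, so the condition as printed fails there. -}

module Defs where

open import Level using (0ℓ)
open import Data.Nat.Base as ℕ using (ℕ; suc; NonZero)
import Data.Nat.Properties as ℕ
open import Data.Integer.Base as ℤ using (+_)
open import Data.Rational.Base using (ℚ; 0ℚ; _+_; _*_; _-_; _/_)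
open import Data.Fin.Base as Fin using (Fin)
import Data.Fin.Properties as Fin
open import Data.List.Base using (List; []; _∷_; _++_; [_]; length; map; filter; foldr; allFin; upTo; cartesianProduct)
open import Data.List.Relation.Unary.Linked using (Linked)
open import Data.List.Relation.Unary.Unique.Propositional using (Unique)
open import Data.Product.Base using (_×_; _,_; ∃; proj₁; proj₂)
open import Data.Sum.Base using (_⊎_)
open import Relation.Binary.Core using (Rel)
open import Relation.Binary.Definitions using (Decidable; Symmetric; Irreflexive)
open import Relation.Binary.Construct.Closure.ReflexiveTransitive using (Star)
open import Relation.Binary.PropositionalEquality.Core using (_≡_; _≢_)
open import Relation.Nullary.Decidable using (Dec; _×-dec_; _⊎-dec_)
open import Relation.Nullary.Negation.Core using (¬_)

record Graph (n : ℕ) : Set₁ where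
  field
    Adj    : Rel (Fin n) 0ℓ
    adj?   : Decidable Adj
    sym    : Symmetric Adj
    irrefl : Irreflexive _≡_ Adj

module _ {n : ℕ} (G : Graph n) where
  open Graph G

  Connected : Set
  Connected = ∀ u v → Star Adj u v

  -- The cycle x, xs, x: distinct vertices, at least three of them.
  IsCycle : Fin n → List (Fin n) → Set
  IsCycle x xs = 2 ℕ.≤ length xs × Unique (x ∷ xs) × Linked Adj (x ∷ xs ++ [ x ])

  Acyclic : Set
  Acyclic = ∀ x xs → ¬ IsCycle x xs

  IsTree : Set
  IsTree = Connected × Acyclic

  degree : Fin n → ℕ
  degree v = length (filter (adj? v) (allFin n))

  HasMaxDegree : ℕ → Set
  HasMaxDegree Δ = (∀ v → degree v ℕ.≤ Δ) × ∃ λ v → degree v ≡ Δ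

  #vertices : ℕ → ℕ
  #vertices i = length (filter (λ v → degree v ℕ.≟ i) (allFin n))

  -- Each edge {u , v} is listed once, as the pair with u < v.
  edges : List (Fin n × Fin n)
  edges = filter (λ e → (proj₁ e Fin.<? proj₂ e) ×-dec adj? (proj₁ e) (proj₂ e))
                 (cartesianProduct (allFin n) (allFin n))

  JoinsDegrees : ℕ → ℕ → Fin n × Fin n → Set
  JoinsDegrees i j (u , v) = (degree u ≡ i × degree v ≡ j) ⊎ (degree u ≡ j × degree v ≡ i)

  joinsDegrees? : ∀ i j e → Dec (JoinsDegrees i j e)
  joinsDegrees? i j (u , v) =
    ((degree u ℕ.≟ i) ×-dec (degree v ℕ.≟ j)) ⊎-dec ((degree u ℕ.≟ j) ×-dec (degree v ℕ.≟ i))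

  #edges : ℕ → ℕ → ℕ
  #edges i j = length (filter (joinsDegrees? i j) edges)

fromℕ : ℕ → ℚ
fromℕ k = + k / 1

sumℚ : List ℚ → ℚ
sumℚ = foldr _+_ 0ℚ

F : (Δ i j : ℕ) .{{_ : NonZero Δ}} .{{_ : NonZero i}} .{{_ : NonZero j}} → ℚ
F Δ i j =
  (fromℕ 4 * fromℕ Δ - fromℕ 6) * (+ 1 / i + + 1 / j)
    + fromℕ Δ * fromℕ Δ - fromℕ 6 * fromℕ Δ + fromℕ 3 + + 6 / Δ
    - (fromℕ i - fromℕ j) * (fromℕ i - fromℕ j)

-- The pair (a , b) stands for (i , j) = (suc a , suc b), so this ranges over 1 ≤ i ≤ j ≤ Δ.
indexPairs : ℕ → List (ℕ × ℕ)
indexPairs Δ = filter (λ p → proj₁ p ℕ.≤? proj₂ p) (cartesianProduct (upTo Δ) (upTo Δ))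

P : ∀ {n} → Graph n → (Δ : ℕ) .{{_ : NonZero Δ}} → ℚ
P T Δ = sumℚ (map (λ (a , b) → F Δ (suc a) (suc b) * fromℕ (#edges T (suc a) (suc b))) (indexPairs Δ))

-- The proviso n ≢ 2Δ on m₂,Δ > 0 cannot be dropped: for n = 2Δ equality is attained by the
-- double star (two adjacent centres with Δ - 1 leaves each), which has no vertex of degree 2,
-- in agreement with n₂ = n / Δ - 2.
record Extremal {n : ℕ} (T : Graph n) (Δ : ℕ) : Set where
  field
    m-Δ-Δ   : #edges T Δ Δ ≡ 1
    m-1-Δ   : 0 ℕ.< #edges T 1 Δ
    m-2-Δ   : n ≢ 2 ℕ.* Δ → 0 ℕ.< #edges T 2 Δ
    m-other : ∀ i j → 1 ℕ.≤ i → i ℕ.≤ j → j ℕ.≤ Δ →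
              (i , j) ≢ (Δ , Δ) → (i , j) ≢ (1 , Δ) → (i , j) ≢ (2 , Δ) →
              #edges T i j ≡ 0

-- The formulas with a subtraction are stated in ℤ to avoid truncation.
record ExtremalCounts {n : ℕ} (T : Graph n) (Δ : ℕ) .{{_ : NonZero Δ}} : Set where
  field
    n-Δ   : #vertices T Δ ≡ n ℕ./ Δ
    n-2   : + #vertices T 2 ≡ + (n ℕ./ Δ) ℤ.- + 2
    n-1   : + #vertices T 1 ≡ (+ Δ ℤ.- + 2) ℤ.* + (n ℕ./ Δ) ℤ.+ + 2
    m-1-Δ : #edges T 1 Δ ≡ #vertices T 1
    m-2-Δ : #edges T 2 Δ ≡ 2 ℕ.* #vertices T 2
    m-Δ-Δ : #edges T Δ Δ ≡ 1

{-# OPTIONS --safe #-}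
-- With M = 2Δ - 3 - i one has
--   F(i, j) = (i - 1)(i - 2) M / i + (Δ - j) ((4Δ - 6) / (j Δ) + Δ + j - 2 i),
-- so for 1 ≤ i ≤ j ≤ Δ the weight is nonnegative, it vanishes only at (1, Δ) and (2, Δ), and it
-- is at least Δ - 3 when j < Δ.  If some edge joins two vertices of degree Δ, then P ≥ F(Δ, Δ)
-- term by term, which also settles equality.  Otherwise every edge meets at most one vertex of
-- degree Δ, so n - 1 - Δ n_Δ edges meet none; as Δ ∣ n this number is -1 modulo Δ, hence at least
-- Δ - 1, and P ≥ (Δ - 1)(Δ - 3) > F(Δ, Δ).  The vertex counts in the case of equality come from
-- counting edge-ends by degree, together with the n - 1 edges of the tree.
module Submission where

open import Defs
open import Data.Bool.Base using (if_then_else_)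
open import Data.Fin.Base using (Fin)
import Data.Fin.Properties as Fin
import Data.Integer.Base as ℤ
import Data.Integer.Properties as ℤ
import Data.Integer.Tactic.RingSolver as ℤ-Solver
open import Data.List.Base using (List; []; _∷_; _++_; [_]; length; map; filter; allFin; upTo; cartesianProduct)
open import Data.List.Membership.Propositional using (_∈_; _∉_)
open import Data.List.Membership.Propositional.Properties using (∈-allFin; ∈-filter⁺; ∈-filter⁻; ∈-cartesianProduct⁺; ∈-cartesianProduct⁻; ∈-upTo⁺; ∈-upTo⁻; ∈-length)
open import Data.List.Membership.Propositional.Properties.WithK using (unique∧set⇒bag)
open import Data.List.Properties using (map-++; map-∘; length-tabulate)
open import Data.List.Relation.Binary.BagAndSetEquality using (∼bag⇒↭)
open import Data.List.Relation.Binary.Permutation.Propositional using (_↭_)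
open import Data.List.Relation.Binary.Permutation.Propositional.Properties using (↭-length) renaming (map⁺ to ↭-map⁺)
open import Data.List.Relation.Unary.All as All using (All; []; _∷_)
import Data.List.Relation.Unary.All.Properties as All
open import Data.List.Relation.Unary.AllPairs using ([]; _∷_)
open import Data.List.Relation.Unary.Any as Any using (here; there)
open import Data.List.Relation.Unary.Linked using (Linked; [-]; _∷_)
open import Data.List.Relation.Unary.Unique.Propositional using (Unique)
import Data.List.Relation.Unary.Unique.Propositional.Properties as Unique
open import Data.Nat.Base as ℕ using (ℕ; zero; suc; NonZero)
open import Data.Nat.Divisibility using (_∣_; ∣⇒≤; ∣m+n∣m⇒∣n; m∣m*n)
open import Data.Nat.DivMod using (m*n/n≡m)
open import Data.Nat.ListAction using (sum)
open import Data.Nat.ListAction.Properties using (sum-++; sum-↭)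
import Data.Nat.Properties as ℕ
open import Data.Nat.Tactic.RingSolver using (solve-∀)
open import Data.Product.Base using (_×_; _,_; ∃; proj₁; proj₂)
open import Data.Product.Properties using (≡-dec)
open import Data.Rational.Base as ℚ using (ℚ; 0ℚ)
import Data.Rational.Properties as ℚ
open import Data.Sum.Base using (_⊎_; inj₁; inj₂)
open import Function.Base using (_∘_; case_of_)
open import Function.Bundles using (_⇔_; mk⇔)
open import Relation.Binary.Construct.Closure.ReflexiveTransitive using (Star; ε; _◅_)
open import Relation.Binary.Definitions using (tri<; tri≈; tri>)
open import Relation.Binary.PropositionalEquality hiding ([_]; J)
open import Relation.Nullary.Decidable using (Dec; yes; no; does; _×-dec_; dec-true; dec-false)
open import Relation.Nullary.Negation.Core using (¬_; contradiction)
open import Relation.Unary using (Pred; Decidable)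

-- The constants in `F` are the unique λ and μ for which λ(1/i + 1/j) + μ - (i - j)² vanishes at
-- both (1, Δ) and (2, Δ); subtracting the two conditions gives λ/2 = 2Δ - 3. Edges of these two
-- kinds are therefore free. In a tree with no other edges, each edge would meet exactly one vertex
-- of degree Δ, so that n = Δ n_Δ + 1. Divisibility forbids this, and some edge of positive weight
-- is forced. One edge between two vertices of degree Δ repairs the count, because it has two such
-- ends: Δ n_Δ = (n - 1) + 1. Its price (Δ - 1)(Δ - 2)(Δ - 3)/Δ is (Δ - 1)(Δ - 3) times (Δ - 2)/Δ,
-- and this factor below 1 is the whole margin over the alternative. The formal difficulty is that
-- `F` has variable denominators while all counting is in ℕ. Writing j = i + l and Δ = j + k removes
-- the subtractions from the weight, and the terms with reciprocals can then be dropped from lower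
-- bounds.

private variable
  A B : Set

∑ : List A → (A → ℕ) → ℕ
∑ xs f = sum (map f xs)

-- Rational arithmetic

module RationalWeights where
  open import Data.Integer.Base using (+_)
  open import Data.Rational.Base hiding (NonZero)
  open import Data.Rational.Properties
  open import Data.Rational.Solver using (module +-*-Solver)
  open +-*-Solver using (solve; con; _:=_; _:+_; _:*_; _:-_)
  open import Data.Rational.Unnormalised.Base as ℚᵘ using (mkℚᵘ; *≡*; *≤*; *<*)
  import Data.Rational.Unnormalised.Properties as ℚᵘ

  -- Normalisation by a gcd blocks computation with a variable numerator or denominator. Both
  -- `fromℕ k` and `+ 1 / n` are `fromℚᵘ` of an explicit unnormalised fraction, for which identities
  -- are cross-multiplications in ℤ.
  fromℚᵘ-homo-+ : ∀ p q → fromℚᵘ (p ℚᵘ.+ q) ≡ fromℚᵘ p + fromℚᵘ q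
  fromℚᵘ-homo-+ p q = toℚᵘ-injective (ℚᵘ.≃-trans (toℚᵘ-fromℚᵘ _) (ℚᵘ.≃-sym
    (ℚᵘ.≃-trans (toℚᵘ-homo-+ (fromℚᵘ p) (fromℚᵘ q)) (ℚᵘ.+-cong (toℚᵘ-fromℚᵘ p) (toℚᵘ-fromℚᵘ q)))))

  fromℚᵘ-homo-* : ∀ p q → fromℚᵘ (p ℚᵘ.* q) ≡ fromℚᵘ p * fromℚᵘ q
  fromℚᵘ-homo-* p q = toℚᵘ-injective (ℚᵘ.≃-trans (toℚᵘ-fromℚᵘ _) (ℚᵘ.≃-sym
    (ℚᵘ.≃-trans (toℚᵘ-homo-* (fromℚᵘ p) (fromℚᵘ q)) (ℚᵘ.*-cong (toℚᵘ-fromℚᵘ p) (toℚᵘ-fromℚᵘ q)))))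

  fromℕ-+ : ∀ m n → fromℕ (m ℕ.+ n) ≡ fromℕ m + fromℕ n
  fromℕ-+ m n = trans
    (fromℚᵘ-cong {mkℚᵘ (+ (m ℕ.+ n)) 0} {mkℚᵘ (+ m) 0 ℚᵘ.+ mkℚᵘ (+ n) 0}
      (*≡* (cong (ℤ._* + 1) (cong₂ ℤ._+_ (sym (ℤ.*-identityʳ (+ m))) (sym (ℤ.*-identityʳ (+ n)))))))
    (fromℚᵘ-homo-+ (mkℚᵘ (+ m) 0) (mkℚᵘ (+ n) 0))

  fromℕ-* : ∀ m n → fromℕ (m ℕ.* n) ≡ fromℕ m * fromℕ n
  fromℕ-* m n = trans
    (fromℚᵘ-cong {mkℚᵘ (+ (m ℕ.* n)) 0} {mkℚᵘ (+ m) 0 ℚᵘ.* mkℚᵘ (+ n) 0}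
      (*≡* (cong (ℤ._* + 1) (ℤ.pos-* m n))))
    (fromℚᵘ-homo-* (mkℚᵘ (+ m) 0) (mkℚᵘ (+ n) 0))

  fromℕ-mono-≤ : ∀ {m n} → m ℕ.≤ n → fromℕ m ≤ fromℕ n
  fromℕ-mono-≤ {m} {n} m≤n = toℚᵘ-cancel-≤ (ℚᵘ.≤-respˡ-≃ (ℚᵘ.≃-sym (toℚᵘ-fromℚᵘ (mkℚᵘ (+ m) 0)))
    (ℚᵘ.≤-respʳ-≃ (ℚᵘ.≃-sym (toℚᵘ-fromℚᵘ (mkℚᵘ (+ n) 0)))
      (*≤* (ℤ.*-monoʳ-≤-nonNeg (+ 1) (ℤ.+≤+ m≤n)))))

  fromℕ-mono-< : ∀ {m n} → m ℕ.< n → fromℕ m < fromℕ n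
  fromℕ-mono-< {m} {n} m<n = toℚᵘ-cancel-< (ℚᵘ.<-respˡ-≃ (ℚᵘ.≃-sym (toℚᵘ-fromℚᵘ (mkℚᵘ (+ m) 0)))
    (ℚᵘ.<-respʳ-≃ (ℚᵘ.≃-sym (toℚᵘ-fromℚᵘ (mkℚᵘ (+ n) 0)))
      (*<* (ℤ.*-monoʳ-<-pos (+ 1) (ℤ.+<+ m<n)))))

  /≡*1/ : ∀ m n .{{_ : NonZero n}} → + m / n ≡ fromℕ m * (+ 1 / n)
  /≡*1/ m (suc n) = trans
    (fromℚᵘ-cong {mkℚᵘ (+ m) n} {mkℚᵘ (+ m) 0 ℚᵘ.* mkℚᵘ (+ 1) n}
      (*≡* (cong₂ ℤ._*_ (sym (ℤ.*-identityʳ (+ m))) (cong +_ (ℕ.*-identityˡ (suc n))))))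
    (fromℚᵘ-homo-* (mkℚᵘ (+ m) 0) (mkℚᵘ (+ 1) n))

  *-1/ : ∀ n .{{_ : NonZero n}} → fromℕ n * (+ 1 / n) ≡ 1ℚ
  *-1/ (suc n) = trans (sym (fromℚᵘ-homo-* (mkℚᵘ (+ suc n) 0) (mkℚᵘ (+ 1) n)))
    (fromℚᵘ-cong {mkℚᵘ (+ suc n) 0 ℚᵘ.* mkℚᵘ (+ 1) n} {mkℚᵘ (+ 1) 0}
      (*≡* (trans (ℤ.*-identityʳ _) (trans (ℤ.*-comm (+ suc n) (+ 1)) (cong (λ k → + 1 ℤ.* + k) (sym (ℕ.*-identityˡ (suc n))))))))

  0≤fromℕ : ∀ n → 0ℚ ≤ fromℕ n
  0≤fromℕ n = nonNegative⁻¹ (fromℕ n) {{normalize-nonNeg n 1}}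

  0<fromℕ : ∀ n .{{_ : NonZero n}} → 0ℚ < fromℕ n
  0<fromℕ n = positive⁻¹ (fromℕ n) {{normalize-pos n 1}}

  0<1/ : ∀ n .{{_ : NonZero n}} → 0ℚ < + 1 / n
  0<1/ n = positive⁻¹ (+ 1 / n) {{normalize-pos 1 n}}

  *-nonNeg : ∀ {p q} → 0ℚ ≤ p → 0ℚ ≤ q → 0ℚ ≤ p * q
  *-nonNeg {p} {q} 0≤p 0≤q = nonNegative⁻¹ (p * q) {{nonNeg*nonNeg⇒nonNeg p {{nonNegative 0≤p}} q {{nonNegative 0≤q}}}}

  *-pos : ∀ {p q} → 0ℚ < p → 0ℚ < q → 0ℚ < p * q
  *-pos {p} {q} 0<p 0<q = positive⁻¹ (p * q) {{pos*pos⇒pos p {{positive 0<p}} q {{positive 0<q}}}}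

  p≤p+q : ∀ {p q} → 0ℚ ≤ q → p ≤ p + q
  p≤p+q {p} {q} 0≤q = subst (_≤ p + q) (+-identityʳ p) (+-monoʳ-≤ p 0≤q)

  p≤q+p : ∀ {p q} → 0ℚ ≤ q → p ≤ q + p
  p≤q+p {p} {q} 0≤q = subst (_≤ q + p) (+-identityˡ p) (+-monoˡ-≤ p 0≤q)

  *-fromℕ-injective : ∀ {p m n} → 0ℚ < p → p * fromℕ m ≡ p * fromℕ n → m ≡ n
  *-fromℕ-injective {p} {m} {n} 0<p eq with ℕ.<-cmp m n
  ... | tri< m<n _ _ = contradiction eq (<⇒≢ (*-monoʳ-<-pos p {{positive 0<p}} (fromℕ-mono-< m<n)))
  ... | tri≈ _ m≡n _ = m≡n
  ... | tri> _ _ n<m = contradiction (sym eq) (<⇒≢ (*-monoʳ-<-pos p {{positive 0<p}} (fromℕ-mono-< n<m)))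

  sumℚ-mono : (xs : List A) {f g : A → ℚ} → (∀ {x} → x ∈ xs → f x ≤ g x) → sumℚ (map f xs) ≤ sumℚ (map g xs)
  sumℚ-mono []       h = ≤-refl
  sumℚ-mono (x ∷ xs) h = +-mono-≤ (h (here refl)) (sumℚ-mono xs (λ x∈ → h (there x∈)))

  sumℚ-cong : (xs : List A) {f g : A → ℚ} → (∀ {x} → x ∈ xs → f x ≡ g x) → sumℚ (map f xs) ≡ sumℚ (map g xs)
  sumℚ-cong []       h = refl
  sumℚ-cong (x ∷ xs) h = cong₂ _+_ (h (here refl)) (sumℚ-cong xs (λ x∈ → h (there x∈)))

  -- A single strict inequality between terms would make the inequality of the sums strict. This
  -- drives the equality case.
  sumℚ-mono-≡ : (xs : List A) {f g : A → ℚ} → (∀ {x} → x ∈ xs → f x ≤ g x) →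
    sumℚ (map f xs) ≡ sumℚ (map g xs) → ∀ {x} → x ∈ xs → f x ≡ g x
  sumℚ-mono-≡ (x ∷ xs) h eq (here refl) =
    ≤-antisym (h (here refl)) (≮⇒≥ (λ f<g → <⇒≢ (+-mono-<-≤ f<g (sumℚ-mono xs (λ x∈ → h (there x∈)))) eq))
  sumℚ-mono-≡ (x ∷ xs) h eq (there y∈) = sumℚ-mono-≡ xs (λ x∈ → h (there x∈))
    (≤-antisym (sumℚ-mono xs (λ x∈ → h (there x∈))) (≮⇒≥ (λ f<g → <⇒≢ (+-mono-≤-< (h (here refl)) f<g) eq))) y∈

  sumℚ-*-fromℕ : (c : ℚ) (xs : List A) (w : A → ℕ) →
    sumℚ (map (λ x → c * fromℕ (w x)) xs) ≡ c * fromℕ (∑ xs w)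
  sumℚ-*-fromℕ c []       w = sym (*-zeroʳ c)
  sumℚ-*-fromℕ c (x ∷ xs) w = begin
    c * fromℕ (w x) + sumℚ (map (λ x → c * fromℕ (w x)) xs) ≡⟨ cong (λ t → c * fromℕ (w x) + t) (sumℚ-*-fromℕ c xs w) ⟩
    c * fromℕ (w x) + c * fromℕ (∑ xs w)                     ≡⟨ *-distribˡ-+ c (fromℕ (w x)) (fromℕ (∑ xs w)) ⟨
    c * (fromℕ (w x) + fromℕ (∑ xs w))                       ≡⟨ cong (λ t → c * t) (fromℕ-+ (w x) (∑ xs w)) ⟨
    c * fromℕ (w x ℕ.+ ∑ xs w)                               ∎
    where open ≡-Reasoning

  -- The weight F

  -- With x = 1 / I this is (I - 1)(I - 2)(2D - 3 - I) / I, the value of F(I, D).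
  F₁ : ℚ → ℚ → ℚ → ℚ
  F₁ D I x = (I - fromℕ 3) * (fromℕ 2 * D - fromℕ 3 - I) + fromℕ 2 * (fromℕ 2 * D - fromℕ 3 - I) * x

  -- The two sides differ by a combination E of I x - 1, J y - 1 and D z - 1.
  F-identity : ∀ I J D x y z → I * x ≡ 1ℚ → J * y ≡ 1ℚ → D * z ≡ 1ℚ →
    (fromℕ 4 * D - fromℕ 6) * (x + y) + D * D - fromℕ 6 * D + fromℕ 3 + fromℕ 6 * z - (I - J) * (I - J)
    ≡ F₁ D I x + ((D - J) * ((fromℕ 4 * D - fromℕ 6) * (y * z)) + (D - J) * (D + J - fromℕ 2 * I))
  F-identity I J D x y z Ix≡1 Jy≡1 Dz≡1 = begin
    _                       ≡⟨ poly I J D x y z ⟩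
    R + E (I * x) (J * y) (D * z) ≡⟨ cong (λ t → R + E t (J * y) (D * z)) Ix≡1 ⟩
    R + E 1ℚ (J * y) (D * z) ≡⟨ cong₂ (λ s t → R + E 1ℚ s t) Jy≡1 Dz≡1 ⟩
    R + E 1ℚ 1ℚ 1ℚ          ≡⟨ cong (λ t → R + t) (vanish D y z) ⟩
    R + 0ℚ                  ≡⟨ +-identityʳ R ⟩
    R                       ∎
    where
    open ≡-Reasoning
    R = F₁ D I x + ((D - J) * ((fromℕ 4 * D - fromℕ 6) * (y * z)) + (D - J) * (D + J - fromℕ 2 * I))
    -- The coefficients come from matching. Taking the `x` part of `F₁` from `(4D - 6) x` leaves
    -- `2 I x`. Expanding `(D - J)(4D - 6) y z` needs `D z` replaced by 1 to recover `(4D - 6) y`,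
    -- and `J y` replaced by 1 to reach `(4D - 6) z`, whose part `4 D z` accounts for the 4.
    E : ℚ → ℚ → ℚ → ℚ
    E r s t = fromℕ 2 * (r - 1ℚ) + (fromℕ 4 * D - fromℕ 6) * z * (s - 1ℚ) + (fromℕ 4 - (fromℕ 4 * D - fromℕ 6) * y) * (t - 1ℚ)
    poly : ∀ I J D x y z →
      (fromℕ 4 * D - fromℕ 6) * (x + y) + D * D - fromℕ 6 * D + fromℕ 3 + fromℕ 6 * z - (I - J) * (I - J)
      ≡ F₁ D I x
        + ((D - J) * ((fromℕ 4 * D - fromℕ 6) * (y * z)) + (D - J) * (D + J - fromℕ 2 * I))
        + (fromℕ 2 * (I * x - 1ℚ) + (fromℕ 4 * D - fromℕ 6) * z * (J * y - 1ℚ)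
           + (fromℕ 4 - (fromℕ 4 * D - fromℕ 6) * y) * (D * z - 1ℚ))
    poly = solve 6 (λ I J D x y z →
      (con (fromℕ 4) :* D :- con (fromℕ 6)) :* (x :+ y) :+ D :* D :- con (fromℕ 6) :* D :+ con (fromℕ 3) :+ con (fromℕ 6) :* z :- (I :- J) :* (I :- J)
      := (I :- con (fromℕ 3)) :* (con (fromℕ 2) :* D :- con (fromℕ 3) :- I) :+ con (fromℕ 2) :* (con (fromℕ 2) :* D :- con (fromℕ 3) :- I) :* x
        :+ ((D :- J) :* ((con (fromℕ 4) :* D :- con (fromℕ 6)) :* (y :* z)) :+ (D :- J) :* (D :+ J :- con (fromℕ 2) :* I))
        :+ (con (fromℕ 2) :* (I :* x :- con 1ℚ) :+ (con (fromℕ 4) :* D :- con (fromℕ 6)) :* z :* (J :* y :- con 1ℚ)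
           :+ (con (fromℕ 4) :- (con (fromℕ 4) :* D :- con (fromℕ 6)) :* y) :* (D :* z :- con 1ℚ))) refl
    vanish : ∀ D y z → fromℕ 2 * (1ℚ - 1ℚ) + (fromℕ 4 * D - fromℕ 6) * z * (1ℚ - 1ℚ)
           + (fromℕ 4 - (fromℕ 4 * D - fromℕ 6) * y) * (1ℚ - 1ℚ) ≡ 0ℚ
    vanish = solve 3 (λ D y z → con (fromℕ 2) :* (con 1ℚ :- con 1ℚ) :+ (con (fromℕ 4) :* D :- con (fromℕ 6)) :* z :* (con 1ℚ :- con 1ℚ)
           :+ (con (fromℕ 4) :- (con (fromℕ 4) :* D :- con (fromℕ 6)) :* y) :* (con 1ℚ :- con 1ℚ) := con 0ℚ) refl

  -- The parameters l = j - i and k = Δ - j turn `D - J` into `k` and `D + J - 2 I` into `2 l + k`,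
  -- both natural numbers, so that signs become visible.
  F-expand : ∀ i l k .{{_ : NonZero i}} .{{_ : NonZero (i ℕ.+ l)}} .{{_ : NonZero (i ℕ.+ l ℕ.+ k)}} →
    F (i ℕ.+ l ℕ.+ k) i (i ℕ.+ l)
    ≡ F₁ (fromℕ (i ℕ.+ l ℕ.+ k)) (fromℕ i) (+ 1 / i)
      + (fromℕ k * ((fromℕ 4 * fromℕ (i ℕ.+ l ℕ.+ k) - fromℕ 6) * ((+ 1 / (i ℕ.+ l)) * (+ 1 / (i ℕ.+ l ℕ.+ k))))
         + fromℕ (k ℕ.* (2 ℕ.* l ℕ.+ k)))
  F-expand i l k = begin
    (fromℕ 4 * D - fromℕ 6) * (x + y) + D * D - fromℕ 6 * D + fromℕ 3 + + 6 / Δ - (I - J) * (I - J)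
      ≡⟨ cong (λ t → (fromℕ 4 * D - fromℕ 6) * (x + y) + D * D - fromℕ 6 * D + fromℕ 3 + t - (I - J) * (I - J)) (/≡*1/ 6 Δ) ⟩
    (fromℕ 4 * D - fromℕ 6) * (x + y) + D * D - fromℕ 6 * D + fromℕ 3 + fromℕ 6 * z - (I - J) * (I - J)
      ≡⟨ F-identity I J D x y z (*-1/ i) (*-1/ j) (*-1/ Δ) ⟩
    F₁ D I x + ((D - J) * ((fromℕ 4 * D - fromℕ 6) * (y * z)) + (D - J) * (D + J - fromℕ 2 * I))
      ≡⟨ cong₂ (λ s t → F₁ D I x + (s * ((fromℕ 4 * D - fromℕ 6) * (y * z)) + t)) D-J≡K tail≡ ⟩
    F₁ D I x + (K * ((fromℕ 4 * D - fromℕ 6) * (y * z)) + fromℕ (k ℕ.* (2 ℕ.* l ℕ.+ k))) ∎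
    where
    open ≡-Reasoning
    j = i ℕ.+ l
    Δ = i ℕ.+ l ℕ.+ k
    I = fromℕ i
    J = fromℕ j
    D = fromℕ Δ
    L = fromℕ l
    K = fromℕ k
    x = + 1 / i
    y = + 1 / j
    z = + 1 / Δ
    D-J≡K : D - J ≡ K
    D-J≡K = trans (cong (_- J) (fromℕ-+ j k)) (solve 2 (λ J K → J :+ K :- J := K) refl J K)
    tail≡ : (D - J) * (D + J - fromℕ 2 * I) ≡ fromℕ (k ℕ.* (2 ℕ.* l ℕ.+ k))
    tail≡ = begin
      (D - J) * (D + J - fromℕ 2 * I)
        ≡⟨ cong₂ (λ s t → s * (t + J - fromℕ 2 * I)) D-J≡K (fromℕ-+ j k) ⟩
      K * (J + K + J - fromℕ 2 * I)
        ≡⟨ cong (λ t → K * (t + K + t - fromℕ 2 * I)) (fromℕ-+ i l) ⟩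
      K * (I + L + K + (I + L) - fromℕ 2 * I)
        ≡⟨ solve 3 (λ I L K → K :* (I :+ L :+ K :+ (I :+ L) :- con (fromℕ 2) :* I) := K :* (con (fromℕ 2) :* L :+ K)) refl I L K ⟩
      K * (fromℕ 2 * L + K)
        ≡⟨ cong (λ t → K * (t + K)) (fromℕ-* 2 l) ⟨
      K * (fromℕ (2 ℕ.* l) + K)
        ≡⟨ cong (λ t → K * t) (fromℕ-+ (2 ℕ.* l) k) ⟨
      K * fromℕ (2 ℕ.* l ℕ.+ k)
        ≡⟨ fromℕ-* k (2 ℕ.* l ℕ.+ k) ⟨
      fromℕ (k ℕ.* (2 ℕ.* l ℕ.+ k)) ∎

  F₁-1 : ∀ D → F₁ D (fromℕ 1) (+ 1 / 1) ≡ 0ℚ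
  F₁-1 = solve 1 (λ D → (con (fromℕ 1) :- con (fromℕ 3)) :* (con (fromℕ 2) :* D :- con (fromℕ 3) :- con (fromℕ 1))
    :+ con (fromℕ 2) :* (con (fromℕ 2) :* D :- con (fromℕ 3) :- con (fromℕ 1)) :* con (+ 1 / 1) := con 0ℚ) refl

  F₁-2 : ∀ D → F₁ D (fromℕ 2) (+ 1 / 2) ≡ 0ℚ
  F₁-2 = solve 1 (λ D → (con (fromℕ 2) :- con (fromℕ 3)) :* (con (fromℕ 2) :* D :- con (fromℕ 3) :- con (fromℕ 2))
    :+ con (fromℕ 2) :* (con (fromℕ 2) :* D :- con (fromℕ 3) :- con (fromℕ 2)) :* con (+ 1 / 2) := con 0ℚ) refl

  -- Division gives (i - 1)(i - 2)/i = i - 3 + 2/i. For i = 3 + a and Δ = i + h the other factor 2Δ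
  -- - 3 - i is the natural number a + 2h, so both summands are nonnegative.
  F₁-3+ : ∀ a h Δ → 3 ℕ.+ a ℕ.+ h ≡ Δ → F₁ (fromℕ Δ) (fromℕ (3 ℕ.+ a)) (+ 1 / (3 ℕ.+ a))
    ≡ fromℕ (a ℕ.* (a ℕ.+ 2 ℕ.* h)) + fromℕ (2 ℕ.* (a ℕ.+ 2 ℕ.* h)) * (+ 1 / (3 ℕ.+ a))
  F₁-3+ a h Δ refl = cong₂ _+_
      (trans (cong₂ _*_ I-3≡a M≡m) (sym (fromℕ-* a m)))
      (cong (_* (+ 1 / (3 ℕ.+ a))) (trans (cong (λ t → fromℕ 2 * t) M≡m) (sym (fromℕ-* 2 m))))
    where
    open ≡-Reasoning
    m = a ℕ.+ 2 ℕ.* h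
    I-3≡a : fromℕ (3 ℕ.+ a) - fromℕ 3 ≡ fromℕ a
    I-3≡a = trans (cong (_- fromℕ 3) (fromℕ-+ 3 a)) (solve 1 (λ A → con (fromℕ 3) :+ A :- con (fromℕ 3) := A) refl (fromℕ a))
    2Δ : ∀ a h → 2 ℕ.* (3 ℕ.+ a ℕ.+ h) ≡ (3 ℕ.+ a) ℕ.+ (3 ℕ.+ (a ℕ.+ 2 ℕ.* h))
    2Δ = solve-∀
    M≡m : fromℕ 2 * fromℕ Δ - fromℕ 3 - fromℕ (3 ℕ.+ a) ≡ fromℕ m
    M≡m = begin
      fromℕ 2 * fromℕ Δ - fromℕ 3 - fromℕ (3 ℕ.+ a)
        ≡⟨ cong (λ t → t - fromℕ 3 - fromℕ (3 ℕ.+ a)) (trans (sym (fromℕ-* 2 Δ)) (trans (cong fromℕ (2Δ a h)) (fromℕ-+ (3 ℕ.+ a) (3 ℕ.+ m)))) ⟩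
      fromℕ (3 ℕ.+ a) + fromℕ (3 ℕ.+ m) - fromℕ 3 - fromℕ (3 ℕ.+ a)
        ≡⟨ cong (λ t → fromℕ (3 ℕ.+ a) + t - fromℕ 3 - fromℕ (3 ℕ.+ a)) (fromℕ-+ 3 m) ⟩
      fromℕ (3 ℕ.+ a) + (fromℕ 3 + fromℕ m) - fromℕ 3 - fromℕ (3 ℕ.+ a)
        ≡⟨ solve 2 (λ I M → I :+ (con (fromℕ 3) :+ M) :- con (fromℕ 3) :- I := M) refl (fromℕ (3 ℕ.+ a)) (fromℕ m) ⟩
      fromℕ m ∎

  F-Δ : ∀ i Δ .{{_ : NonZero i}} .{{_ : NonZero Δ}} → i ℕ.≤ Δ → F Δ i Δ ≡ F₁ (fromℕ Δ) (fromℕ i) (+ 1 / i)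
  F-Δ i Δ i≤Δ = split (ℕ.m≤n⇒∃[o]m+o≡n i≤Δ)
    where
    F-Δ+0 : ∀ l .{{_ : NonZero (i ℕ.+ l)}} .{{_ : NonZero (i ℕ.+ l ℕ.+ 0)}} → F (i ℕ.+ l ℕ.+ 0) i (i ℕ.+ l) ≡ F₁ (fromℕ (i ℕ.+ l ℕ.+ 0)) (fromℕ i) (+ 1 / i)
    F-Δ+0 l = trans (F-expand i l 0) (solve 2 (λ S T → S :+ (con 0ℚ :* T :+ con 0ℚ) := S) refl
      (F₁ (fromℕ (i ℕ.+ l ℕ.+ 0)) (fromℕ i) (+ 1 / i))
      ((fromℕ 4 * fromℕ (i ℕ.+ l ℕ.+ 0) - fromℕ 6) * ((+ 1 / (i ℕ.+ l)) * (+ 1 / (i ℕ.+ l ℕ.+ 0)))))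
    split : (∃ λ l → i ℕ.+ l ≡ Δ) → F Δ i Δ ≡ F₁ (fromℕ Δ) (fromℕ i) (+ 1 / i)
    -- Only the first argument of `F` is rewritten; quantifying the motive over the `NonZero`
    -- instance keeps it well typed.
    split (l , refl) = subst (λ Δ → .{{_ : NonZero Δ}} → F Δ i (i ℕ.+ l) ≡ F₁ (fromℕ Δ) (fromℕ i) (+ 1 / i)) (ℕ.+-identityʳ (i ℕ.+ l)) (F-Δ+0 l)

  F-1-Δ : ∀ Δ .{{_ : NonZero Δ}} → 1 ℕ.≤ Δ → F Δ 1 Δ ≡ 0ℚ
  F-1-Δ Δ 1≤Δ = trans (F-Δ 1 Δ 1≤Δ) (F₁-1 (fromℕ Δ))

  F-2-Δ : ∀ Δ .{{_ : NonZero Δ}} → 2 ℕ.≤ Δ → F Δ 2 Δ ≡ 0ℚ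
  F-2-Δ Δ 2≤Δ = trans (F-Δ 2 Δ 2≤Δ) (F₁-2 (fromℕ Δ))

  -- The fractional summand 2(a + 2l)/i is already positive: a + 2l = 0 would mean i = Δ = 3,
  -- against 4 ≤ Δ.
  F-i-Δ>0 : ∀ i Δ .{{_ : NonZero i}} .{{_ : NonZero Δ}} → 3 ℕ.≤ i → i ℕ.≤ Δ → 4 ℕ.≤ Δ → 0ℚ < F Δ i Δ
  F-i-Δ>0 i Δ 3≤i i≤Δ 4≤Δ = split (ℕ.m≤n⇒∃[o]m+o≡n 3≤i) (ℕ.m≤n⇒∃[o]m+o≡n i≤Δ)
    where
    m≢0 : ∀ a l → 4 ℕ.≤ 3 ℕ.+ a ℕ.+ l → NonZero (2 ℕ.* (a ℕ.+ 2 ℕ.* l))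
    m≢0 (suc a) l       _ = _
    m≢0 zero    (suc l) _ = _
    m≢0 zero    zero    (ℕ.s≤s (ℕ.s≤s (ℕ.s≤s ())))
    split : (∃ λ a → 3 ℕ.+ a ≡ i) → (∃ λ l → i ℕ.+ l ≡ Δ) → 0ℚ < F Δ i Δ
    split (a , refl) (l , refl) = subst (0ℚ <_) (sym (trans (F-Δ i Δ i≤Δ) (F₁-3+ a l Δ refl)))
      (<-≤-trans (*-pos (0<fromℕ (2 ℕ.* (a ℕ.+ 2 ℕ.* l)) {{m≢0 a l 4≤Δ}}) (0<1/ (3 ℕ.+ a)))
                 (p≤q+p (0≤fromℕ (a ℕ.* (a ℕ.+ 2 ℕ.* l)))))

  -- The summand with 1/i is dropped. Truncation makes `i ∸ 3` zero for i = 1 and i = 2, where the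
  -- bound is then the exact value 0.
  F₁≥ : ∀ i h .{{_ : NonZero i}} → fromℕ ((i ℕ.∸ 3) ℕ.* (i ℕ.∸ 3 ℕ.+ 2 ℕ.* h)) ≤ F₁ (fromℕ (i ℕ.+ h)) (fromℕ i) (+ 1 / i)
  F₁≥ 1                   h = ≤-reflexive (sym (F₁-1 (fromℕ (1 ℕ.+ h))))
  F₁≥ 2                   h = ≤-reflexive (sym (F₁-2 (fromℕ (2 ℕ.+ h))))
  F₁≥ (suc (suc (suc a))) h = ≤-trans
    (p≤p+q (*-nonNeg (0≤fromℕ (2 ℕ.* (a ℕ.+ 2 ℕ.* h))) (<⇒≤ (0<1/ (3 ℕ.+ a)))))
    (≤-reflexive (sym (F₁-3+ a h (3 ℕ.+ a ℕ.+ h) refl)))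

  -- A bound by a natural number: what is dropped from `F-expand` is nonnegative because 4Δ ≥ 6.
  F≥ : ∀ i l k .{{_ : NonZero i}} .{{_ : NonZero (i ℕ.+ l)}} .{{_ : NonZero (i ℕ.+ l ℕ.+ k)}} → 4 ℕ.≤ i ℕ.+ l ℕ.+ k →
    fromℕ ((i ℕ.∸ 3) ℕ.* (i ℕ.∸ 3 ℕ.+ 2 ℕ.* (l ℕ.+ k)) ℕ.+ k ℕ.* (2 ℕ.* l ℕ.+ k)) ≤ F (i ℕ.+ l ℕ.+ k) i (i ℕ.+ l)
  F≥ i l k 4≤Δ = begin
    fromℕ (h ℕ.+ t)      ≡⟨ fromℕ-+ h t ⟩
    fromℕ h + fromℕ t    ≤⟨ +-mono-≤ h≤ (p≤q+p rest) ⟩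
    F₁ (fromℕ Δ) (fromℕ i) (+ 1 / i)
      + (fromℕ k * ((fromℕ 4 * fromℕ Δ - fromℕ 6) * ((+ 1 / (i ℕ.+ l)) * (+ 1 / Δ))) + fromℕ t)
                         ≡⟨ F-expand i l k ⟨
    F Δ i (i ℕ.+ l) ∎
    where
    open ≤-Reasoning
    Δ = i ℕ.+ l ℕ.+ k
    h = (i ℕ.∸ 3) ℕ.* (i ℕ.∸ 3 ℕ.+ 2 ℕ.* (l ℕ.+ k))
    t = k ℕ.* (2 ℕ.* l ℕ.+ k)
    h≤ : fromℕ h ≤ F₁ (fromℕ Δ) (fromℕ i) (+ 1 / i)
    h≤ = subst (λ Δ → fromℕ h ≤ F₁ (fromℕ Δ) (fromℕ i) (+ 1 / i)) (sym (ℕ.+-assoc i l k)) (F₁≥ i (l ℕ.+ k))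
    6≤4Δ : fromℕ 6 ≤ fromℕ 4 * fromℕ Δ
    6≤4Δ = ≤-trans (fromℕ-mono-≤ (ℕ.≤-trans (ℕ.m≤m+n 6 10) (ℕ.*-monoʳ-≤ 4 4≤Δ))) (≤-reflexive (fromℕ-* 4 Δ))
    rest : 0ℚ ≤ fromℕ k * ((fromℕ 4 * fromℕ Δ - fromℕ 6) * ((+ 1 / (i ℕ.+ l)) * (+ 1 / Δ)))
    -- The left side of the shifted inequality, `fromℕ 6 - fromℕ 6`, evaluates to `0ℚ`.
    rest = *-nonNeg (0≤fromℕ k) (*-nonNeg (+-monoˡ-≤ (- fromℕ 6) 6≤4Δ)
      (*-nonNeg (<⇒≤ (0<1/ (i ℕ.+ l))) (<⇒≤ (0<1/ Δ))))

  F≥0 : ∀ i j Δ .{{_ : NonZero i}} .{{_ : NonZero j}} .{{_ : NonZero Δ}} → i ℕ.≤ j → j ℕ.≤ Δ → 4 ℕ.≤ Δ → 0ℚ ≤ F Δ i j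
  F≥0 i j Δ i≤j j≤Δ 4≤Δ = split (ℕ.m≤n⇒∃[o]m+o≡n i≤j) (ℕ.m≤n⇒∃[o]m+o≡n j≤Δ)
    where
    split : (∃ λ l → i ℕ.+ l ≡ j) → (∃ λ k → j ℕ.+ k ≡ Δ) → 0ℚ ≤ F Δ i j
    split (l , refl) (k , refl) = ≤-trans (0≤fromℕ ((i ℕ.∸ 3) ℕ.* (i ℕ.∸ 3 ℕ.+ 2 ℕ.* (l ℕ.+ k)) ℕ.+ k ℕ.* (2 ℕ.* l ℕ.+ k))) (F≥ i l k 4≤Δ)

  -- As j < Δ, the gap is `suc k`, so in both products of `F≥` the factor being discarded is at
  -- least 1. What remains is at least (i - 3) + (l + suc k), which reaches Δ - 3.
  F≥Δ-3 : ∀ i j Δ .{{_ : NonZero i}} .{{_ : NonZero j}} .{{_ : NonZero Δ}} → i ℕ.≤ j → j ℕ.< Δ → 4 ℕ.≤ Δ →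
    fromℕ (Δ ℕ.∸ 3) ≤ F Δ i j
  F≥Δ-3 i j Δ i≤j j<Δ 4≤Δ = split (ℕ.m≤n⇒∃[o]m+o≡n i≤j) (ℕ.m≤n⇒∃[o]m+o≡n (ℕ.<⇒≤ j<Δ))
    where
    open ℕ.≤-Reasoning
    bound : ∀ l k → let m = i ℕ.∸ 3 ℕ.+ 2 ℕ.* (l ℕ.+ suc k) in
      i ℕ.+ l ℕ.+ suc k ℕ.∸ 3 ℕ.≤ (i ℕ.∸ 3) ℕ.* m ℕ.+ suc k ℕ.* (2 ℕ.* l ℕ.+ suc k)
    bound l k = begin
      i ℕ.+ l ℕ.+ suc k ℕ.∸ 3       ≡⟨ cong (ℕ._∸ 3) (ℕ.+-assoc i l (suc k)) ⟩
      i ℕ.+ (l ℕ.+ suc k) ℕ.∸ 3     ≤⟨ ℕ.m≤n+o⇒m∸n≤o (i ℕ.+ (l ℕ.+ suc k)) 3 (ℕ.≤-trans (ℕ.+-monoˡ-≤ (l ℕ.+ suc k) (ℕ.m≤n+m∸n i 3)) (ℕ.≤-reflexive (ℕ.+-assoc 3 (i ℕ.∸ 3) (l ℕ.+ suc k)))) ⟩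
      i ℕ.∸ 3 ℕ.+ (l ℕ.+ suc k)     ≤⟨ ℕ.+-mono-≤ (ℕ.m≤m*n (i ℕ.∸ 3) m {{m≢0}}) (ℕ.+-monoˡ-≤ (suc k) (ℕ.m≤n*m l 2)) ⟩
      (i ℕ.∸ 3) ℕ.* m ℕ.+ (2 ℕ.* l ℕ.+ suc k)
                                    ≤⟨ ℕ.+-monoʳ-≤ ((i ℕ.∸ 3) ℕ.* m) (ℕ.m≤n*m (2 ℕ.* l ℕ.+ suc k) (suc k)) ⟩
      (i ℕ.∸ 3) ℕ.* m ℕ.+ suc k ℕ.* (2 ℕ.* l ℕ.+ suc k) ∎
      where
      m = i ℕ.∸ 3 ℕ.+ 2 ℕ.* (l ℕ.+ suc k)
      m≢0 : NonZero m
      m≢0 = ℕ.>-nonZero (begin-strict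
        0                        <⟨ ℕ.z<s ⟩
        suc k                    ≤⟨ ℕ.m≤n+m (suc k) l ⟩
        l ℕ.+ suc k              ≤⟨ ℕ.m≤n*m (l ℕ.+ suc k) 2 ⟩
        2 ℕ.* (l ℕ.+ suc k)      ≤⟨ ℕ.m≤n+m (2 ℕ.* (l ℕ.+ suc k)) (i ℕ.∸ 3) ⟩
        m                        ∎)
    split : (∃ λ l → i ℕ.+ l ≡ j) → (∃ λ k → j ℕ.+ k ≡ Δ) → fromℕ (Δ ℕ.∸ 3) ≤ F Δ i j
    split (l , refl) (zero  , refl) = contradiction (sym (ℕ.+-identityʳ (i ℕ.+ l))) (ℕ.<⇒≢ j<Δ)
    split (l , refl) (suc k , refl) = ≤-trans (fromℕ-mono-≤ (bound l k)) (F≥ i l (suc k) 4≤Δ)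

  -- With Δ = 3 + a the weight is a² + 2a/Δ. Replacing 1/Δ by 1 gives a² + 2a = (Δ - 1)(Δ - 3), a
  -- strict increase because a > 0.
  F-Δ-Δ< : ∀ Δ .{{_ : NonZero Δ}} → 4 ℕ.≤ Δ → F Δ Δ Δ < fromℕ ((Δ ℕ.∸ 1) ℕ.* (Δ ℕ.∸ 3))
  F-Δ-Δ< (suc (suc (suc a))) 4≤Δ = begin-strict
    F Δ Δ Δ                                      ≡⟨ trans (F-Δ Δ Δ ℕ.≤-refl) (F₁-3+ a 0 Δ (ℕ.+-identityʳ Δ)) ⟩
    fromℕ (a ℕ.* (a ℕ.+ 0)) + fromℕ (2 ℕ.* (a ℕ.+ 0)) * x
                                                 <⟨ +-monoʳ-< (fromℕ (a ℕ.* (a ℕ.+ 0))) (*-monoʳ-<-pos (fromℕ (2 ℕ.* (a ℕ.+ 0))) {{normalize-pos (2 ℕ.* (a ℕ.+ 0)) 1 {{_}} {{a≢0 a 4≤Δ}}}} x<1) ⟩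
    fromℕ (a ℕ.* (a ℕ.+ 0)) + fromℕ (2 ℕ.* (a ℕ.+ 0)) * 1ℚ
                                                 ≡⟨ cong (λ t → fromℕ (a ℕ.* (a ℕ.+ 0)) + t) (*-identityʳ (fromℕ (2 ℕ.* (a ℕ.+ 0)))) ⟩
    fromℕ (a ℕ.* (a ℕ.+ 0)) + fromℕ (2 ℕ.* (a ℕ.+ 0))
                                                 ≡⟨ fromℕ-+ (a ℕ.* (a ℕ.+ 0)) (2 ℕ.* (a ℕ.+ 0)) ⟨
    fromℕ (a ℕ.* (a ℕ.+ 0) ℕ.+ 2 ℕ.* (a ℕ.+ 0))  ≡⟨ cong fromℕ (factor a) ⟩
    fromℕ ((2 ℕ.+ a) ℕ.* a)                      ∎
    where
    open ≤-Reasoning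
    Δ = 3 ℕ.+ a
    x = + 1 / Δ
    a≢0 : ∀ a → 4 ℕ.≤ 3 ℕ.+ a → NonZero (2 ℕ.* (a ℕ.+ 0))
    a≢0 (suc a) _ = _
    a≢0 zero    (ℕ.s≤s (ℕ.s≤s (ℕ.s≤s ())))
    factor : ∀ a → a ℕ.* (a ℕ.+ 0) ℕ.+ 2 ℕ.* (a ℕ.+ 0) ≡ (2 ℕ.+ a) ℕ.* a
    factor = solve-∀
    x<1 : x < 1ℚ
    x<1 = begin-strict
      x                          ≡⟨ +-identityʳ x ⟨
      x + 0ℚ                     <⟨ +-monoʳ-< x (*-pos (0<fromℕ (2 ℕ.+ a)) (0<1/ Δ)) ⟩
      x + fromℕ (2 ℕ.+ a) * x    ≡⟨ solve 2 (λ A x → x :+ A :* x := (con (fromℕ 1) :+ A) :* x) refl (fromℕ (2 ℕ.+ a)) x ⟩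
      (fromℕ 1 + fromℕ (2 ℕ.+ a)) * x ≡⟨ cong (_* x) (fromℕ-+ 1 (2 ℕ.+ a)) ⟨
      fromℕ Δ * x                ≡⟨ *-1/ Δ ⟩
      1ℚ                         ∎
  F-Δ-Δ< 1 (ℕ.s≤s ())
  F-Δ-Δ< 2 (ℕ.s≤s (ℕ.s≤s ()))

open RationalWeights
open import Data.Nat.Base
open import Data.Nat.Properties

-- Finite sums

𝟙 : {Q : Set} → Dec Q → ℕ
𝟙 q = if does q then 1 else 0

𝟙-true : {Q : Set} (q : Dec Q) → Q → 𝟙 q ≡ 1
𝟙-true q h = cong (if_then 1 else 0) (dec-true q h)

𝟙-false : {Q : Set} (q : Dec Q) → ¬ Q → 𝟙 q ≡ 0
𝟙-false q h = cong (if_then 1 else 0) (dec-false q h)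

𝟙-cong : {Q R : Set} (q : Dec Q) (r : Dec R) → (Q → R) → (R → Q) → 𝟙 q ≡ 𝟙 r
𝟙-cong (yes q) r f g = sym (𝟙-true r (f q))
𝟙-cong (no ¬q) r f g = sym (𝟙-false r (¬q ∘ g))

*-𝟙 : {a b : ℕ} (q : Dec (a ≡ b)) → a * 𝟙 q ≡ b * 𝟙 q
*-𝟙         (yes refl) = refl
*-𝟙 {a} {b} (no _)     = trans (*-zeroʳ a) (sym (*-zeroʳ b))

∑-cong : (xs : List A) {f g : A → ℕ} → (∀ {x} → x ∈ xs → f x ≡ g x) → ∑ xs f ≡ ∑ xs g
∑-cong []       h = refl
∑-cong (x ∷ xs) h = cong₂ _+_ (h (here refl)) (∑-cong xs (h ∘ there))

∑-+ : (xs : List A) (f g : A → ℕ) → ∑ xs (λ x → f x + g x) ≡ ∑ xs f + ∑ xs g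
∑-+ []       f g = refl
∑-+ (x ∷ xs) f g rewrite ∑-+ xs f g = lemma (f x) (g x) (∑ xs f) (∑ xs g)
  where
  lemma : ∀ a b c d → a + b + (c + d) ≡ a + c + (b + d)
  lemma = solve-∀

∑-*ˡ : (c : ℕ) (xs : List A) (f : A → ℕ) → ∑ xs (λ x → c * f x) ≡ c * ∑ xs f
∑-*ˡ c []       f = sym (*-zeroʳ c)
∑-*ˡ c (x ∷ xs) f rewrite ∑-*ˡ c xs f = sym (*-distribˡ-+ c (f x) (∑ xs f))

∑-0 : (xs : List A) → ∑ xs (λ _ → 0) ≡ 0
∑-0 []       = refl
∑-0 (x ∷ xs) = ∑-0 xs

∑-1 : (xs : List A) → ∑ xs (λ _ → 1) ≡ length xs
∑-1 []       = refl
∑-1 (x ∷ xs) = cong suc (∑-1 xs)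

∑-swap : (xs : List A) (ys : List B) (f : A → B → ℕ) →
  ∑ xs (λ x → ∑ ys (f x)) ≡ ∑ ys (λ y → ∑ xs (λ x → f x y))
∑-swap []       ys f = sym (∑-0 ys)
∑-swap (x ∷ xs) ys f rewrite ∑-swap xs ys f = sym (∑-+ ys (f x) (λ y → ∑ xs (λ x → f x y)))

∑-filter : {Q : Pred A _} (Q? : Decidable Q) (xs : List A) (f : A → ℕ) →
  ∑ (filter Q? xs) f ≡ ∑ xs (λ x → 𝟙 (Q? x) * f x)
∑-filter Q? []       f = refl
∑-filter Q? (x ∷ xs) f with Q? x
... | yes _ = cong₂ _+_ (sym (+-identityʳ (f x))) (∑-filter Q? xs f)
... | no  _ = ∑-filter Q? xs f

length-filter-∑ : {Q : Pred A _} (Q? : Decidable Q) (xs : List A) →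
  length (filter Q? xs) ≡ ∑ xs (λ x → 𝟙 (Q? x))
length-filter-∑ Q? xs = begin
  length (filter Q? xs)         ≡⟨ ∑-1 (filter Q? xs) ⟨
  ∑ (filter Q? xs) (λ _ → 1)    ≡⟨ ∑-filter Q? xs (λ _ → 1) ⟩
  ∑ xs (λ x → 𝟙 (Q? x) * 1)     ≡⟨ ∑-cong xs (λ {x} _ → *-identityʳ (𝟙 (Q? x))) ⟩
  ∑ xs (λ x → 𝟙 (Q? x))         ∎
  where open ≡-Reasoning

∑-cartesianProduct : (xs : List A) (ys : List B) (f : A × B → ℕ) →
  ∑ (cartesianProduct xs ys) f ≡ ∑ xs (λ x → ∑ ys (λ y → f (x , y)))
∑-cartesianProduct []       ys f = refl
∑-cartesianProduct (x ∷ xs) ys f = begin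
  sum (map f (map (x ,_) ys ++ zs))           ≡⟨ cong sum (map-++ f (map (x ,_) ys) zs) ⟩
  sum (map f (map (x ,_) ys) ++ map f zs)     ≡⟨ sum-++ (map f (map (x ,_) ys)) (map f zs) ⟩
  sum (map f (map (x ,_) ys)) + ∑ zs f        ≡⟨ cong₂ _+_ (cong sum (sym (map-∘ ys))) (∑-cartesianProduct xs ys f) ⟩
  ∑ ys (λ y → f (x , y)) + ∑ xs (λ x → ∑ ys (λ y → f (x , y))) ∎
  where
  open ≡-Reasoning
  zs = cartesianProduct xs ys

∑-point : {xs : List A} {q : A} (f : A → ℕ) → Unique xs → q ∈ xs →
  (∀ {x} → x ∈ xs → x ≢ q → f x ≡ 0) → ∑ xs f ≡ f q
∑-point {xs = x ∷ xs} f (x∉xs ∷ _) (here refl) h =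
  trans (cong (f x +_) (trans (∑-cong xs (λ y∈ → h (there y∈) (λ y≡x → All.lookup x∉xs y∈ (sym y≡x)))) (∑-0 xs)))
        (+-identityʳ (f x))
∑-point {xs = x ∷ xs} f (x∉xs ∷ u) (there q∈) h
  rewrite h (here refl) (All.lookup x∉xs q∈) = ∑-point f u q∈ (h ∘ there)

∑-↭ : {xs ys : List A} (f : A → ℕ) → xs ↭ ys → ∑ xs f ≡ ∑ ys f
∑-↭ f p = sum-↭ (↭-map⁺ f p)

∑-three : {f : A → ℕ} {xs : List A} (_≟ᴬ_ : (x y : A) → Dec (x ≡ y)) → Unique xs →
  ∀ {q r s} → q ∈ xs → r ∈ xs → s ∈ xs → q ≢ r → q ≢ s → r ≢ s →
  (∀ {x} → x ∈ xs → x ≢ q → x ≢ r → x ≢ s → f x ≡ 0) → ∑ xs f ≡ f q + (f r + f s)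
∑-three {f = f} {xs} _≟ᴬ_ u {q} {r} {s} q∈ r∈ s∈ q≢r q≢s r≢s zero-else = begin
  ∑ xs f                                               ≡⟨ ∑-cong xs (λ {x} x∈ → split x x∈) ⟩
  ∑ xs (λ x → at q x + (at r x + at s x))              ≡⟨ ∑-+ xs (at q) (λ x → at r x + at s x) ⟩
  ∑ xs (at q) + ∑ xs (λ x → at r x + at s x)           ≡⟨ cong (∑ xs (at q) +_) (∑-+ xs (at r) (at s)) ⟩
  ∑ xs (at q) + (∑ xs (at r) + ∑ xs (at s))            ≡⟨ cong₂ _+_ (∑-at q∈) (cong₂ _+_ (∑-at r∈) (∑-at s∈)) ⟩
  f q + (f r + f s)                                    ∎
  where
  open ≡-Reasoning
  at : _ → _ → ℕ
  at q x = 𝟙 (x ≟ᴬ q) * f x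
  at-≡ : ∀ q → at q q ≡ f q
  at-≡ q = trans (cong (_* f q) (𝟙-true (q ≟ᴬ q) refl)) (+-identityʳ (f q))
  at-≢ : ∀ {q x} → x ≢ q → at q x ≡ 0
  at-≢ {q} {x} x≢q = cong (_* f x) (𝟙-false (x ≟ᴬ q) x≢q)
  ∑-at : ∀ {q} → q ∈ xs → ∑ xs (at q) ≡ f q
  ∑-at {q} q∈ = trans (∑-point (at q) u q∈ (λ _ → at-≢)) (at-≡ q)
  split : ∀ x → x ∈ xs → f x ≡ at q x + (at r x + at s x)
  split x x∈ with x ≟ᴬ q | x ≟ᴬ r | x ≟ᴬ s
  ... | yes refl | yes x≡r  | _        = contradiction x≡r q≢r
  ... | yes refl | no _     | yes x≡s  = contradiction x≡s q≢s
  ... | yes refl | no _     | no _     = sym (trans (+-identityʳ _) (+-identityʳ _))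
  ... | no _     | yes refl | yes x≡s  = contradiction x≡s r≢s
  ... | no _     | yes refl | no _     = sym (trans (+-identityʳ _) (+-identityʳ _))
  ... | no _     | no _     | yes refl = sym (+-identityʳ _)
  ... | no x≢q   | no x≢r   | no x≢s   = zero-else x∈ x≢q x≢r x≢s

-- Counting in graphs

module _ {n : ℕ} (G : Graph n) where
  open Graph G renaming (sym to adj-sym)

  adj : Fin n → Fin n → ℕ
  adj u v = 𝟙 (adj? u v)

  adj-comm : ∀ u v → adj u v ≡ adj v u
  adj-comm u v = 𝟙-cong (adj? u v) (adj? v u) adj-sym adj-sym

  adj-irrefl : ∀ u → adj u u ≡ 0
  adj-irrefl u = 𝟙-false (adj? u u) (irrefl refl)

  degree-∑ : ∀ u → degree G u ≡ ∑ (allFin n) (adj u)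
  degree-∑ u = length-filter-∑ (adj? u) (allFin n)

  -- Double counting: exchanging the names of `u` and `v` in the second half of the sum turns edges
  -- listed once into ordered adjacent pairs, since exactly one orientation of each satisfies u < v.
  -- Taking `h` constant counts edges; letting `h` depend on its first argument alone counts
  -- edge-ends.
  ∑-edges : (h : Fin n → Fin n → ℕ) →
    ∑ (edges G) (λ (u , v) → h u v + h v u) ≡ ∑ (allFin n) (λ u → ∑ (allFin n) (λ v → adj u v * h u v))
  ∑-edges h = begin
    ∑ (edges G) (λ (u , v) → h u v + h v u)
      ≡⟨ ∑-filter (λ e → (proj₁ e Fin.<? proj₂ e) ×-dec adj? (proj₁ e) (proj₂ e)) (cartesianProduct V V) (λ (u , v) → h u v + h v u) ⟩
    ∑ (cartesianProduct V V) (λ (u , v) → ord u v * (h u v + h v u))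
      ≡⟨ ∑-cartesianProduct V V (λ (u , v) → ord u v * (h u v + h v u)) ⟩
    ∑ V (λ u → ∑ V (λ v → ord u v * (h u v + h v u)))
      ≡⟨ ∑-cong V (λ {u} _ → ∑-cong V (λ {v} _ → *-distribˡ-+ (ord u v) (h u v) (h v u))) ⟩
    ∑ V (λ u → ∑ V (λ v → ord u v * h u v + ord u v * h v u))
      ≡⟨ ∑-cong V (λ {u} _ → ∑-+ V (λ v → ord u v * h u v) (λ v → ord u v * h v u)) ⟩
    ∑ V (λ u → ∑ V (λ v → ord u v * h u v) + ∑ V (λ v → ord u v * h v u))
      ≡⟨ ∑-+ V (λ u → ∑ V (λ v → ord u v * h u v)) (λ u → ∑ V (λ v → ord u v * h v u)) ⟩
    ∑ V (λ u → ∑ V (λ v → ord u v * h u v)) + ∑ V (λ u → ∑ V (λ v → ord u v * h v u))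
      ≡⟨ cong (∑ V (λ u → ∑ V (λ v → ord u v * h u v)) +_) (∑-swap V V (λ u v → ord u v * h v u)) ⟩
    ∑ V (λ u → ∑ V (λ v → ord u v * h u v)) + ∑ V (λ u → ∑ V (λ v → ord v u * h u v))
      ≡⟨ ∑-+ V (λ u → ∑ V (λ v → ord u v * h u v)) (λ u → ∑ V (λ v → ord v u * h u v)) ⟨
    ∑ V (λ u → ∑ V (λ v → ord u v * h u v) + ∑ V (λ v → ord v u * h u v))
      ≡⟨ ∑-cong V (λ {u} _ → ∑-+ V (λ v → ord u v * h u v) (λ v → ord v u * h u v)) ⟨
    ∑ V (λ u → ∑ V (λ v → ord u v * h u v + ord v u * h u v))
      ≡⟨ ∑-cong V (λ {u} _ → ∑-cong V (λ {v} _ → trans (sym (*-distribʳ-+ (h u v) (ord u v) (ord v u))) (cong (_* h u v) (ord-adj u v)))) ⟩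
    ∑ V (λ u → ∑ V (λ v → adj u v * h u v)) ∎
    where
    open ≡-Reasoning
    V = allFin n
    ord : Fin n → Fin n → ℕ
    ord u v = 𝟙 ((u Fin.<? v) ×-dec adj? u v)
    ord-adj : ∀ u v → ord u v + ord v u ≡ adj u v
    ord-adj u v with Fin.<-cmp u v
    ... | tri< u<v _ v≮u = trans
      (cong₂ _+_ (𝟙-cong ((u Fin.<? v) ×-dec adj? u v) (adj? u v) proj₂ (u<v ,_)) (𝟙-false ((v Fin.<? u) ×-dec adj? v u) (v≮u ∘ proj₁)))
      (+-identityʳ _)
    ... | tri≈ u≮v refl _ = trans
      (cong₂ _+_ (𝟙-false ((u Fin.<? u) ×-dec adj? u u) (u≮v ∘ proj₁)) (𝟙-false ((u Fin.<? u) ×-dec adj? u u) (u≮v ∘ proj₁)))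
      (sym (adj-irrefl u))
    ... | tri> u≮v _ v<u =
      cong₂ _+_ (𝟙-false ((u Fin.<? v) ×-dec adj? u v) (u≮v ∘ proj₁)) (𝟙-cong ((v Fin.<? u) ×-dec adj? v u) (adj? u v) (adj-sym ∘ proj₂) (λ a → v<u , adj-sym a))

  handshake : length (edges G) + length (edges G) ≡ ∑ (allFin n) (λ u → ∑ (allFin n) (adj u))
  handshake = begin
    length E + length E               ≡⟨ cong₂ _+_ (∑-1 E) (∑-1 E) ⟨
    ∑ E (λ _ → 1) + ∑ E (λ _ → 1)     ≡⟨ ∑-+ E (λ _ → 1) (λ _ → 1) ⟨
    ∑ E (λ _ → 2)                     ≡⟨ ∑-edges (λ _ _ → 1) ⟩
    ∑ V (λ u → ∑ V (λ v → adj u v * 1)) ≡⟨ ∑-cong V (λ {u} _ → ∑-cong V (λ {v} _ → *-identityʳ (adj u v))) ⟩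
    ∑ V (λ u → ∑ V (adj u)) ∎
    where
    open ≡-Reasoning
    E = edges G
    V = allFin n

  ∑-degree-ends : ∀ d → ∑ (edges G) (λ (u , v) → 𝟙 (degree G u ≟ d) + 𝟙 (degree G v ≟ d)) ≡ d * #vertices G d
  ∑-degree-ends d = begin
    ∑ (edges G) (λ (u , v) → 𝟙 (degree G u ≟ d) + 𝟙 (degree G v ≟ d))
      ≡⟨ ∑-edges (λ u _ → 𝟙 (degree G u ≟ d)) ⟩
    ∑ V (λ u → ∑ V (λ v → adj u v * 𝟙 (degree G u ≟ d)))
      ≡⟨ ∑-cong V (λ {u} _ → ends u) ⟩
    ∑ V (λ u → d * 𝟙 (degree G u ≟ d))
      ≡⟨ ∑-*ˡ d V (λ u → 𝟙 (degree G u ≟ d)) ⟩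
    d * ∑ V (λ u → 𝟙 (degree G u ≟ d))
      ≡⟨ cong (d *_) (length-filter-∑ (λ u → degree G u ≟ d) V) ⟨
    d * #vertices G d ∎
    where
    open ≡-Reasoning
    V = allFin n
    ends : ∀ u → ∑ V (λ v → adj u v * 𝟙 (degree G u ≟ d)) ≡ d * 𝟙 (degree G u ≟ d)
    ends u = begin
      ∑ V (λ v → adj u v * 𝟙 (degree G u ≟ d)) ≡⟨ ∑-cong V (λ {v} _ → *-comm (adj u v) (𝟙 (degree G u ≟ d))) ⟩
      ∑ V (λ v → 𝟙 (degree G u ≟ d) * adj u v) ≡⟨ ∑-*ˡ (𝟙 (degree G u ≟ d)) V (adj u) ⟩
      𝟙 (degree G u ≟ d) * ∑ V (adj u)         ≡⟨ cong (𝟙 (degree G u ≟ d) *_) (degree-∑ u) ⟨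
      𝟙 (degree G u ≟ d) * degree G u          ≡⟨ *-comm (𝟙 (degree G u ≟ d)) (degree G u) ⟩
      degree G u * 𝟙 (degree G u ≟ d)          ≡⟨ *-𝟙 (degree G u ≟ d) ⟩
      d * 𝟙 (degree G u ≟ d)                   ∎

  -- Trees grown vertex by vertex, and their number of edges.

  data Walk : Fin n → Fin n → List (Fin n) → Set where
    stop : ∀ {x} → Walk x x [ x ]
    step : ∀ {x y z p} → Adj x y → Walk y z p → Walk x z (x ∷ p)

  walk-snoc : ∀ {x y z p} → Walk x y p → Adj y z → Walk x z (p ++ [ z ])
  walk-snoc stop       a = step a stop
  walk-snoc (step b w) a = step b (walk-snoc w a)

  -- For z = v this is the closing condition of `IsCycle`. The two outer vertices are kept apart
  -- because the induction moves `v` along the walk while `z` stays.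
  walk-closed : ∀ {v x y z p} → Adj v x → Walk x y p → Adj y z → Linked Adj (v ∷ p ++ [ z ])
  walk-closed a stop       b = a ∷ b ∷ [-]
  walk-closed a (step c w) b = a ∷ walk-closed c w b

  walk-length : ∀ {x y p} → x ≢ y → Walk x y p → 2 ≤ length p
  walk-length x≢y stop                = contradiction refl x≢y
  walk-length _   (step _ stop)       = s≤s (s≤s z≤n)
  walk-length _   (step _ (step _ _)) = s≤s (s≤s z≤n)

  PathIn : List (Fin n) → Fin n → Fin n → Set
  PathIn S x y = ∃ λ p → Walk x y p × Unique p × All (_∈ S) p

  -- The vertex sets of subtrees, in the order in which the vertices are attached.
  data Grown : List (Fin n) → Set where
    root   : ∀ r → Grown [ r ]
    attach : ∀ {S} u w → Grown S → u ∈ S → w ∉ S → Adj u w → Grown (w ∷ S)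

  ∉⇒All-≢ : {w : Fin n} {S p : List (Fin n)} → w ∉ S → All (_∈ S) p → All (w ≢_) p
  ∉⇒All-≢ w∉S = All.map (λ { x∈S refl → w∉S x∈S })

  grown-unique : ∀ {S} → Grown S → Unique S
  grown-unique (root r)              = [] ∷ []
  grown-unique (attach u w g _ w∉S _) = All.tabulate (λ { x∈S refl → w∉S x∈S }) ∷ grown-unique g

  -- A path that starts or ends at the newest vertex `w` goes through its neighbour `u`; it stays
  -- free of repetitions because `w` is outside the older set.
  grown-path : ∀ {S x y} → Grown S → x ∈ S → y ∈ S → PathIn S x y
  grown-path (root r) (here refl) (here refl) = [ r ] , stop , [] ∷ [] , here refl ∷ []
  grown-path (attach u w g u∈S w∉S a) (here refl) (here refl) = [ w ] , stop , [] ∷ [] , here refl ∷ []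
  grown-path (attach u w g u∈S w∉S a) (here refl) (there y∈S) with grown-path g u∈S y∈S
  ... | p , walk , unique , p⊆S = w ∷ p , step (adj-sym a) walk , ∉⇒All-≢ w∉S p⊆S ∷ unique , here refl ∷ All.map there p⊆S
  grown-path (attach u w g u∈S w∉S a) (there x∈S) (here refl) with grown-path g x∈S u∈S
  ... | p , walk , unique , p⊆S = p ++ [ w ] , walk-snoc walk a
      , Unique.++⁺ unique ([] ∷ []) (λ { (z∈p , here refl) → w∉S (All.lookup p⊆S z∈p) })
      , All.++⁺ (All.map there p⊆S) (here refl ∷ [])
  grown-path (attach u w g u∈S w∉S a) (there x∈S) (there y∈S) with grown-path g x∈S y∈S
  ... | p , walk , unique , p⊆S = p , walk , unique , All.map there p⊆S

  -- The walk is followed edge by edge: its next vertex either lies in the set already or can be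
  -- attached to the current one.
  grown-reach : ∀ {S x y} → Grown S → x ∈ S → Star Adj x y → ∃ λ S′ → Grown S′ × (∀ {z} → z ∈ S → z ∈ S′) × y ∈ S′
  grown-reach g x∈S ε = _ , g , (λ z∈S → z∈S) , x∈S
  grown-reach {S} g x∈S (_◅_ {_} {y} a walk) with Any.any? (y Fin.≟_) S
  ... | yes y∈S = grown-reach g y∈S walk
  ... | no  y∉S with grown-reach (attach _ y g x∈S y∉S a) (here refl) walk
  ...   | S′ , g′ , S⊆S′ , z∈S′ = S′ , g′ , S⊆S′ ∘ there , z∈S′

  grown-cover : Connected G → Fin n → (vs : List (Fin n)) → ∃ λ S → Grown S × All (_∈ S) vs
  grown-cover conn r []       = [ r ] , root r , []
  grown-cover conn r (v ∷ vs) with grown-cover conn r vs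
  ... | S , g , vs⊆S with pick g
    where
    pick : ∀ {S} → Grown S → ∃ (_∈ S)
    pick (root r)             = r , here refl
    pick (attach _ w _ _ _ _) = w , here refl
  ...   | x , x∈S with grown-reach g x∈S (conn x v)
  ...     | S′ , g′ , S⊆S′ , v∈S′ = S′ , g′ , v∈S′ ∷ All.map S⊆S′ vs⊆S

  -- Two neighbours of w in S would be joined by a path in S, closing a cycle through w.
  attach-degree : Acyclic G → ∀ {S u w} → Grown S → u ∈ S → w ∉ S → Adj u w → ∑ S (adj w) ≡ 1
  attach-degree acyclic {S} {u} {w} g u∈S w∉S a =
    trans (∑-point (adj w) (grown-unique g) u∈S other) (𝟙-true (adj? w u) (adj-sym a))
    where
    other : ∀ {x} → x ∈ S → x ≢ u → adj w x ≡ 0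
    other {x} x∈S x≢u = 𝟙-false (adj? w x) λ b → case grown-path g x∈S u∈S of
      λ (p , walk , unique , p⊆S) →
        acyclic w p (walk-length x≢u walk , ∉⇒All-≢ w∉S p⊆S ∷ unique , walk-closed b walk a)

  -- The double sum counts ordered adjacent pairs inside `S`. A new vertex has one neighbour there
  -- and adds two pairs, one in its row and one in its column. The 2 on the left avoids subtracting.
  grown-ends : Acyclic G → ∀ {S} → Grown S → 2 + ∑ S (λ u → ∑ S (adj u)) ≡ length S + length S
  grown-ends acyclic (root r) = cong (λ k → 2 + (k + 0 + 0)) (adj-irrefl r)
  grown-ends acyclic (attach {S} u w g u∈S w∉S a) = begin
    2 + (adj w w + ∑ S (adj w) + ∑ S (λ x → adj x w + ∑ S (adj x)))
      ≡⟨ cong₂ (λ s t → 2 + (s + t)) (cong₂ _+_ (adj-irrefl w) d) (∑-+ S (λ x → adj x w) (λ x → ∑ S (adj x))) ⟩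
    2 + (1 + (∑ S (λ x → adj x w) + ∑ S (λ x → ∑ S (adj x))))
      ≡⟨ cong (λ k → 3 + (k + ∑ S (λ x → ∑ S (adj x)))) (trans (∑-cong S (λ {x} _ → adj-comm x w)) d) ⟩
    2 + (2 + ∑ S (λ x → ∑ S (adj x)))
      ≡⟨ cong (2 +_) (grown-ends acyclic g) ⟩
    2 + (length S + length S)
      ≡⟨ cong suc (+-suc (length S) (length S)) ⟨
    suc (length S) + suc (length S) ∎
    where
    open ≡-Reasoning
    d = attach-degree acyclic g u∈S w∉S a

  -- A grown set that covers every vertex is a permutation of `allFin n`, so `grown-ends` meets
  -- `handshake`, and both sides are halved. The given vertex rules out the empty graph, where the
  -- equation fails.
  tree-edges : IsTree G → Fin n → suc (length (edges G)) ≡ n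
  tree-edges (conn , acyclic) r with grown-cover conn r (allFin n)
  ... | S , g , V⊆S = halve (suc (length E)) n (begin
    suc (length E) + suc (length E)        ≡⟨ cong suc (+-suc (length E) (length E)) ⟩
    2 + (length E + length E)              ≡⟨ cong (2 +_) handshake ⟩
    2 + ∑ V (λ u → ∑ V (adj u))            ≡⟨ cong (2 +_) (∑-cong V (λ {u} _ → ∑-↭ (adj u) V↭S)) ⟩
    2 + ∑ V (λ u → ∑ S (adj u))            ≡⟨ cong (2 +_) (∑-↭ (λ u → ∑ S (adj u)) V↭S) ⟩
    2 + ∑ S (λ u → ∑ S (adj u))            ≡⟨ grown-ends acyclic g ⟩
    length S + length S                    ≡⟨ cong₂ _+_ len len ⟩
    n + n                                  ∎)
    where
    open ≡-Reasoning
    E = edges G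
    V = allFin n
    V↭S : V ↭ S
    V↭S = ∼bag⇒↭ (unique∧set⇒bag (Unique.allFin⁺ n) (grown-unique g) (mk⇔ (All.lookup V⊆S) (λ _ → ∈-allFin _)))
    len : length S ≡ n
    len = trans (sym (↭-length V↭S)) (length-tabulate {n = n} (λ x → x))
    halve : ∀ a b → a + a ≡ b + b → a ≡ b
    halve a b eq = *-cancelˡ-≡ a b 2 (trans (double a) (trans eq (sym (double b))))
      where
      double : ∀ c → 2 * c ≡ c + c
      double c = cong (c +_) (+-identityʳ c)

-- Sums over pairs of degrees

indexPairs-unique : ∀ Δ → Unique (indexPairs Δ)
indexPairs-unique Δ = Unique.filter⁺ (λ p → proj₁ p ≤? proj₂ p) (Unique.cartesianProduct⁺ (Unique.upTo⁺ Δ) (Unique.upTo⁺ Δ))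

∈-indexPairs⁺ : ∀ {Δ a b} → a ≤ b → b < Δ → (a , b) ∈ indexPairs Δ
∈-indexPairs⁺ a≤b b<Δ = ∈-filter⁺ (λ p → proj₁ p ≤? proj₂ p)
  (∈-cartesianProduct⁺ (∈-upTo⁺ (≤-<-trans a≤b b<Δ)) (∈-upTo⁺ b<Δ)) a≤b

∈-indexPairs⁻ : ∀ Δ {a b} → (a , b) ∈ indexPairs Δ → a ≤ b × b < Δ
∈-indexPairs⁻ Δ p∈ with ∈-filter⁻ (λ p → proj₁ p ≤? proj₂ p) {xs = cartesianProduct (upTo Δ) (upTo Δ)} p∈
... | p∈′ , a≤b = a≤b , ∈-upTo⁻ (proj₂ (∈-cartesianProduct⁻ (upTo Δ) (upTo Δ) p∈′))

_≟ₚ_ : (p q : ℕ × ℕ) → Dec (p ≡ q)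
_≟ₚ_ = ≡-dec _≟_ _≟_

module _ {n : ℕ} (T : Graph n) (Δ : ℕ) where
  m : ℕ × ℕ → ℕ
  m (a , b) = #edges T (suc a) (suc b)

  weighted : (ℕ → ℕ → ℕ) → ℕ
  weighted w = ∑ (indexPairs Δ) (λ p → w (suc (proj₁ p)) (suc (proj₂ p)) * m p)

  -- The bridge from degree classes to edges: after exchanging the sums, each edge lies in exactly
  -- one class with 1 ≤ i ≤ j ≤ Δ. Symmetry of `w` is required because an edge may list its larger
  -- degree first.
  weighted-edges : (∀ v → 1 ≤ degree T v × degree T v ≤ Δ) → (w : ℕ → ℕ → ℕ) → (∀ i j → w i j ≡ w j i) →
    weighted w ≡ ∑ (edges T) (λ e → w (degree T (proj₁ e)) (degree T (proj₂ e)))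
  weighted-edges bounds w w-sym = begin
    ∑ L (λ p → wₚ p * m p)
      ≡⟨ ∑-cong L (λ {p} _ → trans (cong (wₚ p *_) (length-filter-∑ (joins? p) E)) (sym (∑-*ˡ (wₚ p) E (λ e → 𝟙 (joins? p e))))) ⟩
    ∑ L (λ p → ∑ E (λ e → wₚ p * 𝟙 (joins? p e)))
      ≡⟨ ∑-swap L E (λ p e → wₚ p * 𝟙 (joins? p e)) ⟩
    ∑ E (λ e → ∑ L (λ p → wₚ p * 𝟙 (joins? p e)))
      ≡⟨ ∑-cong E (λ {e} _ → unique-pair e) ⟩
    ∑ E (λ e → w (degree T (proj₁ e)) (degree T (proj₂ e))) ∎
    where
    open ≡-Reasoning
    L = indexPairs Δ
    E = edges T
    wₚ : ℕ × ℕ → ℕ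
    wₚ p = w (suc (proj₁ p)) (suc (proj₂ p))
    joins? : ∀ p e → Dec (JoinsDegrees T (suc (proj₁ p)) (suc (proj₂ p)) e)
    joins? p = joinsDegrees? T (suc (proj₁ p)) (suc (proj₂ p))

    at-pair : ∀ e {a b} → a ≤ b → b < Δ → JoinsDegrees T (suc a) (suc b) e → ∑ L (λ p → wₚ p * 𝟙 (joins? p e)) ≡ w (suc a) (suc b)
    at-pair (u , v) {a} {b} a≤b b<Δ joins = trans
      (∑-point (λ p → wₚ p * 𝟙 (joins? p (u , v))) (indexPairs-unique Δ) (∈-indexPairs⁺ a≤b b<Δ)
        (λ {p} p∈ p≢ → trans (cong (wₚ p *_) (𝟙-false (joins? p (u , v)) (λ h → p≢ (same p∈ h joins)))) (*-zeroʳ (wₚ p))))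
      (trans (cong (w (suc a) (suc b) *_) (𝟙-true (joins? (a , b) (u , v)) joins)) (*-identityʳ _))
      where
      -- An edge read in opposite orientations gives c = b and d = a; as both pairs are ordered, a =
      -- b.
      crossed : ∀ {c d} → (c , d) ∈ L → c ≡ b → d ≡ a → (c , d) ≡ (a , b)
      crossed p∈ refl refl with ≤-antisym a≤b (proj₁ (∈-indexPairs⁻ Δ p∈))
      ... | refl = refl
      same : ∀ {p} → p ∈ L → JoinsDegrees T (suc (proj₁ p)) (suc (proj₂ p)) (u , v) → JoinsDegrees T (suc a) (suc b) (u , v) → p ≡ (a , b)
      same p∈ (inj₁ (x , y)) (inj₁ (x′ , y′)) = cong₂ _,_ (suc-injective (trans (sym x) x′)) (suc-injective (trans (sym y) y′))
      same p∈ (inj₂ (x , y)) (inj₂ (x′ , y′)) = cong₂ _,_ (suc-injective (trans (sym y) y′)) (suc-injective (trans (sym x) x′))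
      same p∈ (inj₁ (x , y)) (inj₂ (x′ , y′)) = crossed p∈ (suc-injective (trans (sym x) x′)) (suc-injective (trans (sym y) y′))
      same p∈ (inj₂ (x , y)) (inj₁ (x′ , y′)) = crossed p∈ (suc-injective (trans (sym y) y′)) (suc-injective (trans (sym x) x′))

    unique-pair : ∀ e → ∑ L (λ p → wₚ p * 𝟙 (joins? p e)) ≡ w (degree T (proj₁ e)) (degree T (proj₂ e))
    unique-pair (u , v) = by-degrees (degree T u) (degree T v) refl refl (bounds u) (bounds v)
      where
      by-degrees : ∀ i j → degree T u ≡ i → degree T v ≡ j → 1 ≤ degree T u × degree T u ≤ Δ → 1 ≤ degree T v × degree T v ≤ Δ →
        ∑ L (λ p → wₚ p * 𝟙 (joins? p (u , v))) ≡ w (degree T u) (degree T v)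
      by-degrees zero    _       u≡ v≡ (1≤u , _) _ = contradiction u≡ (>⇒≢ 1≤u)
      by-degrees (suc _) zero    u≡ v≡ _ (1≤v , _) = contradiction v≡ (>⇒≢ 1≤v)
      by-degrees (suc a) (suc b) u≡ v≡ (_ , u≤Δ) (_ , v≤Δ) with ≤-total a b
      ... | inj₁ a≤b = trans (at-pair (u , v) a≤b (subst (_≤ Δ) v≡ v≤Δ) (inj₁ (u≡ , v≡))) (sym (cong₂ w u≡ v≡))
      ... | inj₂ b≤a = trans (at-pair (u , v) b≤a (subst (_≤ Δ) u≡ u≤Δ) (inj₂ (u≡ , v≡)))
        (trans (w-sym (suc b) (suc a)) (sym (cong₂ w u≡ v≡)))

module _ {n : ℕ} (T : Graph n) where
  open Graph T using (Adj; adj?)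

  adjacent⇒degree>0 : ∀ {u v} → Adj u v → 1 ≤ degree T u
  adjacent⇒degree>0 {u} {v} a = ∈-length (∈-filter⁺ (adj? u) (∈-allFin v) a)

  connected⇒degree>0 : Connected T → ∀ {u} → 1 ≤ degree T u → ∀ v → 1 ≤ degree T v
  connected⇒degree>0 conn {u} 1≤u v with conn v u
  ... | ε     = 1≤u
  ... | a ◅ _ = adjacent⇒degree>0 a

  #vertices≡0 : ∀ {d} → #vertices T d ≡ 0 → ∀ v → degree T v ≢ d
  #vertices≡0 {d} none v eq =
    contradiction none (>⇒≢ (∈-length (∈-filter⁺ (λ v → degree T v ≟ d) (∈-allFin v) eq)))

-- Writing Δ = 4 + e lets the comparisons of Δ with 1 and 2 compute.
module Bound {n : ℕ} (e : ℕ) (T : Graph n) (tree : IsTree T) (maxDegree : HasMaxDegree T (4 + e)) where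

  Δ δ : ℕ
  Δ = 4 + e
  δ = 3 + e

  4≤Δ : 4 ≤ Δ
  4≤Δ = m≤m+n 4 e

  L : List (ℕ × ℕ)
  L = indexPairs Δ

  mᵖ : ℕ × ℕ → ℕ
  mᵖ = m T Δ

  W : (ℕ → ℕ → ℕ) → ℕ
  W = weighted T Δ

  ends : ℕ → ℕ → ℕ → ℕ
  ends d i j = 𝟙 (i ≟ d) + 𝟙 (j ≟ d)

  degree-bounds : ∀ v → 1 ≤ degree T v × degree T v ≤ Δ
  degree-bounds v = connected⇒degree>0 T (proj₁ tree) (subst (1 ≤_) (sym (proj₂ (proj₂ maxDegree))) (s≤s z≤n)) v , proj₁ maxDegree v

  W-1 : suc (W (λ _ _ → 1)) ≡ n
  W-1 = trans (cong suc (trans (weighted-edges T Δ degree-bounds (λ _ _ → 1) (λ _ _ → refl)) (∑-1 (edges T))))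
              (tree-edges T tree (proj₁ (proj₂ maxDegree)))

  W-ends : ∀ d → W (ends d) ≡ d * #vertices T d
  W-ends d = trans (weighted-edges T Δ degree-bounds (ends d) (λ i j → +-comm (𝟙 (i ≟ d)) (𝟙 (j ≟ d)))) (∑-degree-ends T d)

  i≡Δ⇒j≡Δ : ∀ {a b} → (a , b) ∈ L → suc a ≡ Δ → suc b ≡ Δ
  i≡Δ⇒j≡Δ p∈ refl with ∈-indexPairs⁻ Δ p∈
  ... | a≤b , b<Δ = ≤-antisym b<Δ (s≤s a≤b)

  δδ∈L : (δ , δ) ∈ L
  δδ∈L = ∈-indexPairs⁺ ≤-refl ≤-refl

  -- Testing `i` alone isolates the corner, since i ≤ j ≤ Δ and i = Δ force j = Δ.
  ∑-ΔΔ : (f : ℕ × ℕ → ℕ) → ∑ L (λ p → 𝟙 (suc (proj₁ p) ≟ Δ) * f p) ≡ f (δ , δ)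
  ∑-ΔΔ f = trans (∑-point (λ p → 𝟙 (suc (proj₁ p) ≟ Δ) * f p) (indexPairs-unique Δ) δδ∈L
      (λ {p} p∈ p≢ → cong (_* f p) (𝟙-false (suc (proj₁ p) ≟ Δ) (λ i≡Δ → p≢ (cong₂ _,_ (suc-injective i≡Δ) (suc-injective (i≡Δ⇒j≡Δ p∈ i≡Δ)))))))
    (trans (cong (_* f (δ , δ)) (𝟙-true (Δ ≟ Δ) refl)) (+-identityʳ _))

  -- Edges that avoid the vertices of degree Δ.

  inner : ℕ → ℕ → ℕ
  inner i j = 𝟙 (j <? Δ)

  -- The edges at degree-Δ vertices number Δ n_Δ, those joining two such vertices counted twice.
  W-inner : W inner + Δ * #vertices T Δ + 1 ≡ n + #edges T Δ Δ
  W-inner = begin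
    W inner + Δ * #vertices T Δ + 1
      ≡⟨ cong (λ k → W inner + k + 1) (W-ends Δ) ⟨
    W inner + W (ends Δ) + 1
      ≡⟨ cong (_+ 1) (∑-+ L (λ p → inner (suc (proj₁ p)) (suc (proj₂ p)) * mᵖ p) (λ p → ends Δ (suc (proj₁ p)) (suc (proj₂ p)) * mᵖ p)) ⟨
    ∑ L (λ p → inner (suc (proj₁ p)) (suc (proj₂ p)) * mᵖ p + ends Δ (suc (proj₁ p)) (suc (proj₂ p)) * mᵖ p) + 1
      ≡⟨ cong (_+ 1) (∑-cong L (λ {p} p∈ → pointwise p p∈)) ⟩
    ∑ L (λ p → 1 * mᵖ p + 𝟙 (suc (proj₁ p) ≟ Δ) * mᵖ p) + 1
      ≡⟨ cong (_+ 1) (∑-+ L (λ p → 1 * mᵖ p) (λ p → 𝟙 (suc (proj₁ p) ≟ Δ) * mᵖ p)) ⟩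
    W (λ _ _ → 1) + ∑ L (λ p → 𝟙 (suc (proj₁ p) ≟ Δ) * mᵖ p) + 1
      ≡⟨ cong (λ k → W (λ _ _ → 1) + k + 1) (∑-ΔΔ mᵖ) ⟩
    W (λ _ _ → 1) + #edges T Δ Δ + 1
      ≡⟨ +-comm _ 1 ⟩
    suc (W (λ _ _ → 1)) + #edges T Δ Δ
      ≡⟨ cong (_+ #edges T Δ Δ) W-1 ⟩
    n + #edges T Δ Δ ∎
    where
    open ≡-Reasoning
    coefficient : ∀ {a b} → (a , b) ∈ L → inner (suc a) (suc b) + ends Δ (suc a) (suc b) ≡ 1 + 𝟙 (suc a ≟ Δ)
    coefficient {a} {b} p∈ with m≤n⇒m<n∨m≡n (proj₂ (∈-indexPairs⁻ Δ p∈))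
    ... | inj₁ j<Δ = cong₂ _+_ (𝟙-true (suc b <? Δ) j<Δ)
      (trans (cong (𝟙 (suc a ≟ Δ) +_) (𝟙-false (suc b ≟ Δ) (<⇒≢ j<Δ))) (+-identityʳ _))
    ... | inj₂ refl = trans (cong₂ (λ s t → s + (𝟙 (suc a ≟ Δ) + t)) (𝟙-false (Δ <? Δ) (<-irrefl refl)) (𝟙-true (Δ ≟ Δ) refl))
      (+-comm (𝟙 (suc a ≟ Δ)) 1)
    pointwise : ∀ p → p ∈ L → inner (suc (proj₁ p)) (suc (proj₂ p)) * mᵖ p + ends Δ (suc (proj₁ p)) (suc (proj₂ p)) * mᵖ p
      ≡ 1 * mᵖ p + 𝟙 (suc (proj₁ p) ≟ Δ) * mᵖ p
    pointwise p p∈ = trans (sym (*-distribʳ-+ (mᵖ p) (inner (suc (proj₁ p)) (suc (proj₂ p))) (ends Δ (suc (proj₁ p)) (suc (proj₂ p)))))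
      (trans (cong (_* mᵖ p) (coefficient p∈)) (*-distribʳ-+ (mᵖ p) 1 (𝟙 (suc (proj₁ p) ≟ Δ))))

  -- The lower bound for `P`.

  FΔΔ : ℚ
  FΔΔ = F Δ Δ Δ

  Fᵖ : ℕ × ℕ → ℚ
  Fᵖ p = F Δ (suc (proj₁ p)) (suc (proj₂ p))

  FΔΔ>0 : 0ℚ ℚ.< FΔΔ
  FΔΔ>0 = F-i-Δ>0 Δ Δ (m≤m+n 3 (suc e)) ≤-refl 4≤Δ

  Fᵖ≥0 : ∀ {p} → p ∈ L → 0ℚ ℚ.≤ Fᵖ p
  Fᵖ≥0 {a , b} p∈ = F≥0 (suc a) (suc b) Δ (s≤s (proj₁ (∈-indexPairs⁻ Δ p∈))) (proj₂ (∈-indexPairs⁻ Δ p∈)) 4≤Δ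

  mΔΔ≡0⇒FΔΔ<P : #edges T Δ Δ ≡ 0 → Δ ∣ n → FΔΔ ℚ.< P T Δ
  mΔΔ≡0⇒FΔΔ<P none Δ∣n = begin-strict
    FΔΔ                                       <⟨ F-Δ-Δ< Δ 4≤Δ ⟩
    fromℕ (δ * (Δ ∸ 3))                       ≤⟨ fromℕ-mono-≤ (≤-trans (*-monoˡ-≤ (Δ ∸ 3) δ≤inner) (≤-reflexive (*-comm (W inner) (Δ ∸ 3)))) ⟩
    fromℕ ((Δ ∸ 3) * W inner)                 ≡⟨ fromℕ-* (Δ ∸ 3) (W inner) ⟩
    fromℕ (Δ ∸ 3) ℚ.* fromℕ (W inner)         ≡⟨ sumℚ-*-fromℕ (fromℕ (Δ ∸ 3)) L (λ p → inner (suc (proj₁ p)) (suc (proj₂ p)) * mᵖ p) ⟨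
    sumℚ (map (λ p → fromℕ (Δ ∸ 3) ℚ.* fromℕ (inner (suc (proj₁ p)) (suc (proj₂ p)) * mᵖ p)) L)
                                              ≤⟨ sumℚ-mono L (λ {p} p∈ → pointwise p p∈) ⟩
    P T Δ                                     ∎
    where
    open ℚ.≤-Reasoning
    count : Δ * #vertices T Δ + suc (W inner) ≡ n
    count = trans (trans (rearrange (Δ * #vertices T Δ) (W inner)) W-inner) (trans (cong (n +_) none) (+-identityʳ n))
      where
      rearrange : ∀ x y → x + suc y ≡ y + x + 1
      rearrange = solve-∀
    -- By `count`, Δ divides `suc (W inner)`, which is positive and hence at least Δ.
    δ≤inner : δ ≤ W inner
    δ≤inner = s≤s⁻¹ (∣⇒≤ (∣m+n∣m⇒∣n (subst (Δ ∣_) (sym count) Δ∣n) (m∣m*n (#vertices T Δ))))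
    -- The indicator is abstracted to `k`, so that matching on `refl` can replace it by 1 or 0.
    scaled : ∀ k {p} → p ∈ L → (k ≡ 1 × suc (proj₂ p) < Δ) ⊎ k ≡ 0 → fromℕ (Δ ∸ 3) ℚ.* fromℕ (k * mᵖ p) ℚ.≤ Fᵖ p ℚ.* fromℕ (mᵖ p)
    scaled k {p} p∈ (inj₁ (refl , j<Δ)) = ℚ.≤-trans
      (ℚ.≤-reflexive (cong (λ k → fromℕ (Δ ∸ 3) ℚ.* fromℕ k) (+-identityʳ (mᵖ p))))
      (ℚ.*-monoʳ-≤-nonNeg (fromℕ (mᵖ p)) {{ℚ.normalize-nonNeg (mᵖ p) 1}}
        (F≥Δ-3 (suc (proj₁ p)) (suc (proj₂ p)) Δ (s≤s (proj₁ (∈-indexPairs⁻ Δ p∈))) j<Δ 4≤Δ))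
    scaled k {p} p∈ (inj₂ refl) = ℚ.≤-trans (ℚ.≤-reflexive (ℚ.*-zeroʳ (fromℕ (Δ ∸ 3)))) (*-nonNeg (Fᵖ≥0 p∈) (0≤fromℕ (mᵖ p)))
    inner-cases : ∀ j → (𝟙 (j <? Δ) ≡ 1 × j < Δ) ⊎ 𝟙 (j <? Δ) ≡ 0
    inner-cases j with j <? Δ
    ... | yes j<Δ = inj₁ (𝟙-true (j <? Δ) j<Δ , j<Δ)
    ... | no  j≮Δ = inj₂ (𝟙-false (j <? Δ) j≮Δ)
    pointwise : ∀ p → p ∈ L → fromℕ (Δ ∸ 3) ℚ.* fromℕ (inner (suc (proj₁ p)) (suc (proj₂ p)) * mᵖ p) ℚ.≤ Fᵖ p ℚ.* fromℕ (mᵖ p)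
    pointwise p p∈ = scaled (𝟙 (suc (proj₂ p) <? Δ)) p∈ (inner-cases (suc (proj₂ p)))

  -- `FΔΔ` spread over the index list of `P` as its only nonzero term, so that the comparison and
  -- its equality case are both termwise.
  corner : ℕ × ℕ → ℚ
  corner p = FΔΔ ℚ.* fromℕ (𝟙 (suc (proj₁ p) ≟ Δ) * 1)

  sumℚ-corner : sumℚ (map corner L) ≡ FΔΔ
  sumℚ-corner = trans (sumℚ-*-fromℕ FΔΔ L (λ p → 𝟙 (suc (proj₁ p) ≟ Δ) * 1))
    (trans (cong (λ k → FΔΔ ℚ.* fromℕ k) (∑-ΔΔ (λ _ → 1))) (ℚ.*-identityʳ FΔΔ))

  corner-ΔΔ : corner (δ , δ) ≡ FΔΔ ℚ.* fromℕ 1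
  corner-ΔΔ = cong (λ k → FΔΔ ℚ.* fromℕ (k * 1)) (𝟙-true (Δ ≟ Δ) refl)

  corner-else : ∀ {p} → p ∈ L → p ≢ (δ , δ) → corner p ≡ 0ℚ
  corner-else {p} p∈ p≢ = trans (cong (λ k → FΔΔ ℚ.* fromℕ (k * 1)) (𝟙-false (suc (proj₁ p) ≟ Δ)
      (λ i≡Δ → p≢ (cong₂ _,_ (suc-injective i≡Δ) (suc-injective (i≡Δ⇒j≡Δ p∈ i≡Δ))))))
    (ℚ.*-zeroʳ FΔΔ)

  corner≤ : 1 ≤ #edges T Δ Δ → ∀ {p} → p ∈ L → corner p ℚ.≤ Fᵖ p ℚ.* fromℕ (mᵖ p)
  corner≤ 1≤mΔΔ {p} p∈ = by-cases (p ≟ₚ (δ , δ))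
    where
    by-cases : Dec (p ≡ (δ , δ)) → corner p ℚ.≤ Fᵖ p ℚ.* fromℕ (mᵖ p)
    by-cases (yes refl) = ℚ.≤-trans (ℚ.≤-reflexive corner-ΔΔ)
      (ℚ.*-monoˡ-≤-nonNeg FΔΔ {{ℚ.nonNegative (ℚ.<⇒≤ FΔΔ>0)}} (fromℕ-mono-≤ 1≤mΔΔ))
    by-cases (no p≢) = ℚ.≤-trans (ℚ.≤-reflexive (corner-else p∈ p≢)) (*-nonNeg (Fᵖ≥0 p∈) (0≤fromℕ (mᵖ p)))

  P≥FΔΔ : Δ ∣ n → FΔΔ ℚ.≤ P T Δ
  P≥FΔΔ Δ∣n = by-cases (#edges T Δ Δ) refl
    where
    by-cases : ∀ k → #edges T Δ Δ ≡ k → FΔΔ ℚ.≤ P T Δ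
    by-cases zero    eq = ℚ.<⇒≤ (mΔΔ≡0⇒FΔΔ<P eq Δ∣n)
    by-cases (suc k) eq = ℚ.≤-trans (ℚ.≤-reflexive (sym sumℚ-corner)) (sumℚ-mono L (corner≤ (subst (1 ≤_) (sym eq) (s≤s z≤n))))

  -- The case of equality.

  -- These are the conditions that equality yields term by term; `Counts` derives the positivity
  -- statements of `Extremal` from vertex counts.
  Concentrated : Set
  Concentrated = #edges T Δ Δ ≡ 1 ×
    (∀ i j → 1 ≤ i → i ≤ j → j ≤ Δ → (i , j) ≢ (Δ , Δ) → (i , j) ≢ (1 , Δ) → (i , j) ≢ (2 , Δ) → #edges T i j ≡ 0)

  F>0 : ∀ {a b} → (a , b) ∈ L → _≢_ {A = ℕ × ℕ} (suc a , suc b) (1 , Δ) → _≢_ {A = ℕ × ℕ} (suc a , suc b) (2 , Δ) → 0ℚ ℚ.< F Δ (suc a) (suc b)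
  F>0 {a} {b} p∈ ≢1Δ ≢2Δ = by-cases a (m≤n⇒m<n∨m≡n (proj₂ (∈-indexPairs⁻ Δ p∈))) ≢1Δ ≢2Δ (proj₁ (∈-indexPairs⁻ Δ p∈))
    where
    by-cases : ∀ a → suc b < Δ ⊎ suc b ≡ Δ → _≢_ {A = ℕ × ℕ} (suc a , suc b) (1 , Δ) → _≢_ {A = ℕ × ℕ} (suc a , suc b) (2 , Δ) → a ≤ b → 0ℚ ℚ.< F Δ (suc a) (suc b)
    by-cases a             (inj₁ j<Δ)  _   _   a≤b = ℚ.<-≤-trans (0<fromℕ (Δ ∸ 3)) (F≥Δ-3 (suc a) (suc b) Δ (s≤s a≤b) j<Δ 4≤Δ)
    by-cases 0             (inj₂ refl) ≢1Δ _   _   = contradiction refl ≢1Δ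
    by-cases 1             (inj₂ refl) _   ≢2Δ _   = contradiction refl ≢2Δ
    by-cases (suc (suc a)) (inj₂ refl) _   _   a≤b = F-i-Δ>0 (3 + a) Δ (m≤m+n 3 a) (s≤s a≤b) 4≤Δ

  -- Equality excludes m = 0 at (Δ, Δ), where the bound is strict, so the comparison with `corner`
  -- applies and is exact in each term. Cancelling the positive weight leaves m = 1 at the corner
  -- and m = 0 wherever else the weight is positive.
  equality⇒concentrated : Δ ∣ n → P T Δ ≡ FΔΔ → Concentrated
  equality⇒concentrated Δ∣n P≡ = sym (*-fromℕ-injective FΔΔ>0 (trans (sym corner-ΔΔ) (pointwise δδ∈L))) , other
    where
    mΔΔ>0 : 1 ≤ #edges T Δ Δ
    mΔΔ>0 = n≢0⇒n>0 (λ none → contradiction (sym P≡) (ℚ.<⇒≢ (mΔΔ≡0⇒FΔΔ<P none Δ∣n)))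
    pointwise : ∀ {p} → p ∈ L → corner p ≡ Fᵖ p ℚ.* fromℕ (mᵖ p)
    pointwise = sumℚ-mono-≡ L (corner≤ mΔΔ>0) (trans sumℚ-corner (sym P≡))
    other : ∀ i j → 1 ≤ i → i ≤ j → j ≤ Δ → (i , j) ≢ (Δ , Δ) → (i , j) ≢ (1 , Δ) → (i , j) ≢ (2 , Δ) → #edges T i j ≡ 0
    other (suc a) (suc b) _ (s≤s a≤b) b<Δ ≢ΔΔ ≢1Δ ≢2Δ = sym (*-fromℕ-injective (F>0 p∈ ≢1Δ ≢2Δ)
        (trans (ℚ.*-zeroʳ (F Δ (suc a) (suc b))) (trans (sym (corner-else p∈ (λ { refl → ≢ΔΔ refl }))) (pointwise p∈))))
      where
      p∈ : (a , b) ∈ L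
      p∈ = ∈-indexPairs⁺ a≤b b<Δ

  concentrated-else : Concentrated → ∀ {p} → p ∈ L → p ≢ (0 , δ) → p ≢ (1 , δ) → p ≢ (δ , δ) → mᵖ p ≡ 0
  concentrated-else (_ , other) {a , b} p∈ ≢0δ ≢1δ ≢δδ =
    other (suc a) (suc b) (s≤s z≤n) (s≤s (proj₁ (∈-indexPairs⁻ Δ p∈))) (proj₂ (∈-indexPairs⁻ Δ p∈))
      (λ { refl → ≢δδ refl }) (λ { refl → ≢0δ refl }) (λ { refl → ≢1δ refl })

  concentrated⇒equality : Concentrated → P T Δ ≡ FΔΔ
  concentrated⇒equality c = trans (sumℚ-cong L (λ {p} p∈ → by-cases p∈ (p ≟ₚ (0 , δ)) (p ≟ₚ (1 , δ)) (p ≟ₚ (δ , δ)))) sumℚ-corner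
    where
    by-cases : ∀ {p} → p ∈ L → Dec (p ≡ (0 , δ)) → Dec (p ≡ (1 , δ)) → Dec (p ≡ (δ , δ)) → Fᵖ p ℚ.* fromℕ (mᵖ p) ≡ corner p
    by-cases p∈ (yes refl) _ _ = trans (trans (cong (ℚ._* fromℕ (mᵖ (0 , δ))) (F-1-Δ Δ (s≤s z≤n))) (ℚ.*-zeroˡ (fromℕ (mᵖ (0 , δ)))))
      (sym (corner-else p∈ (λ ())))
    by-cases p∈ (no _) (yes refl) _ = trans (trans (cong (ℚ._* fromℕ (mᵖ (1 , δ))) (F-2-Δ Δ (s≤s (s≤s z≤n)))) (ℚ.*-zeroˡ (fromℕ (mᵖ (1 , δ)))))
      (sym (corner-else p∈ (λ ())))
    by-cases p∈ (no _) (no _) (yes refl) = trans (cong (λ k → FΔΔ ℚ.* fromℕ k) (proj₁ c)) (sym corner-ΔΔ)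
    by-cases {p} p∈ (no ≢0δ) (no ≢1δ) (no ≢δδ) = trans (cong (λ k → Fᵖ p ℚ.* fromℕ k) (concentrated-else c p∈ ≢0δ ≢1δ ≢δδ))
      (trans (ℚ.*-zeroʳ (Fᵖ p)) (sym (corner-else p∈ ≢δδ)))

  -- With `ends 1`, `ends 2`, `ends Δ` and the constant 1 for `w`, this produces the linear system
  -- from which `Counts` is solved.
  W-concentrated : Concentrated → ∀ w → W w ≡ w 1 Δ * #edges T 1 Δ + (w 2 Δ * #edges T 2 Δ + w Δ Δ * 1)
  W-concentrated c w = trans
    (∑-three _≟ₚ_ (indexPairs-unique Δ) (∈-indexPairs⁺ z≤n ≤-refl) (∈-indexPairs⁺ (s≤s z≤n) ≤-refl) δδ∈L (λ ()) (λ ()) (λ ())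
      (λ {p} p∈ ≢0δ ≢1δ ≢δδ → trans (cong (w (suc (proj₁ p)) (suc (proj₂ p)) *_) (concentrated-else c p∈ ≢0δ ≢1δ ≢δδ)) (*-zeroʳ (w (suc (proj₁ p)) (suc (proj₂ p))))))
    (cong (λ k → w 1 Δ * #edges T 1 Δ + (w 2 Δ * #edges T 2 Δ + w Δ Δ * k)) (proj₁ c))

  -- Vertex and edge counts under equality.

  module Counts (c : Concentrated) where
    n₁ n₂ nᵟ m₁ m₂ : ℕ
    n₁ = #vertices T 1
    n₂ = #vertices T 2
    nᵟ = #vertices T Δ
    m₁ = #edges T 1 Δ
    m₂ = #edges T 2 Δ

    m₁≡n₁ : m₁ ≡ n₁
    m₁≡n₁ = begin
      m₁                        ≡⟨ expand m₁ m₂ ⟨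
      1 * m₁ + (0 * m₂ + 0 * 1) ≡⟨ W-concentrated c (ends 1) ⟨
      W (ends 1)                ≡⟨ W-ends 1 ⟩
      1 * n₁                    ≡⟨ +-identityʳ n₁ ⟩
      n₁                        ∎
      where
      open ≡-Reasoning
      expand : ∀ x y → 1 * x + (0 * y + 0 * 1) ≡ x
      expand = solve-∀

    m₂≡2n₂ : m₂ ≡ 2 * n₂
    m₂≡2n₂ = begin
      m₂                        ≡⟨ expand m₁ m₂ ⟨
      0 * m₁ + (1 * m₂ + 0 * 1) ≡⟨ W-concentrated c (ends 2) ⟨
      W (ends 2)                ≡⟨ W-ends 2 ⟩
      2 * n₂                    ∎
      where
      open ≡-Reasoning
      expand : ∀ x y → 0 * x + (1 * y + 0 * 1) ≡ y
      expand = solve-∀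

    n≡m₁+m₂+2 : n ≡ m₁ + m₂ + 2
    n≡m₁+m₂+2 = trans (sym W-1) (trans (cong suc (W-concentrated c (λ _ _ → 1))) (expand m₁ m₂))
      where
      expand : ∀ x y → suc (1 * x + (1 * y + 1 * 1)) ≡ x + y + 2
      expand = solve-∀

    -- Each edge has one end of degree Δ, except for the single edge that has two. This surplus of 1
    -- is also the surplus of vertices over edges.
    Δnᵟ≡n : Δ * nᵟ ≡ n
    Δnᵟ≡n = begin
      Δ * nᵟ                    ≡⟨ W-ends Δ ⟨
      W (ends Δ)                ≡⟨ W-concentrated c (ends Δ) ⟩
      ends Δ 1 Δ * m₁ + (ends Δ 2 Δ * m₂ + ends Δ Δ Δ * 1)
                                -- `Δ ≟ Δ` does not compute for a variable `e`, so its indicator is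
                                -- rewritten explicitly; the corner contributes it twice.
                                ≡⟨ cong (λ k → k * m₁ + (k * m₂ + (k + k) * 1)) (𝟙-true (Δ ≟ Δ) refl) ⟩
      1 * m₁ + (1 * m₂ + 2 * 1) ≡⟨ expand m₁ m₂ ⟩
      m₁ + m₂ + 2               ≡⟨ n≡m₁+m₂+2 ⟨
      n                         ∎
      where
      open ≡-Reasoning
      expand : ∀ x y → 1 * x + (1 * y + 2 * 1) ≡ x + y + 2
      expand = solve-∀

    -- A vertex of degree d ≥ 1 would be an end of some edge, and every edge present has its end
    -- degrees among 1, 2 and Δ.
    no-other-degree : ∀ d → d ≢ 1 → d ≢ 2 → d ≢ Δ → 1 ≤ d → #vertices T d ≡ 0
    no-other-degree d ≢1 ≢2 ≢Δ 1≤d = m*n≡0⇒m≡0 (#vertices T d) d {{>-nonZero 1≤d}} (trans (*-comm (#vertices T d) d) eq)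
      where
      eq : d * #vertices T d ≡ 0
      eq = begin
        d * #vertices T d ≡⟨ W-ends d ⟨
        W (ends d)        ≡⟨ W-concentrated c (ends d) ⟩
        ends d 1 Δ * m₁ + (ends d 2 Δ * m₂ + ends d Δ Δ * 1)
          ≡⟨ cong₂ _+_ (cong (_* m₁) (cong₂ _+_ (off ≢1) (off ≢Δ))) (cong₂ _+_ (cong (_* m₂) (cong₂ _+_ (off ≢2) (off ≢Δ))) (cong (_* 1) (cong₂ _+_ (off ≢Δ) (off ≢Δ)))) ⟩
        0 ∎
        where
        open ≡-Reasoning
        off : ∀ {i} → d ≢ i → 𝟙 (i ≟ d) ≡ 0
        off {i} d≢i = 𝟙-false (i ≟ d) (d≢i ∘ sym)

    n≡n₁+n₂+nᵟ : n ≡ n₁ + (n₂ + nᵟ)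
    n≡n₁+n₂+nᵟ = begin
      n                                   ≡⟨ length-tabulate {n = n} (λ x → x) ⟨
      length V                            ≡⟨ ∑-1 V ⟨
      ∑ V (λ _ → 1)                       ≡⟨ ∑-cong V (λ {v} _ → one v) ⟩
      ∑ V (λ v → is 1 v + (is 2 v + is Δ v)) ≡⟨ ∑-+ V (is 1) (λ v → is 2 v + is Δ v) ⟩
      ∑ V (is 1) + ∑ V (λ v → is 2 v + is Δ v) ≡⟨ cong (∑ V (is 1) +_) (∑-+ V (is 2) (is Δ)) ⟩
      ∑ V (is 1) + (∑ V (is 2) + ∑ V (is Δ)) ≡⟨ cong₂ _+_ (count 1) (cong₂ _+_ (count 2) (count Δ)) ⟨
      n₁ + (n₂ + nᵟ) ∎
      where
      open ≡-Reasoning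
      V = allFin n
      is : ℕ → Fin n → ℕ
      is d v = 𝟙 (degree T v ≟ d)
      count : ∀ d → #vertices T d ≡ ∑ V (is d)
      count d = length-filter-∑ (λ v → degree T v ≟ d) V
      exactly-one : ∀ d → 1 ≤ d → (∀ k → k ≢ 1 → k ≢ 2 → k ≢ Δ → 1 ≤ k → d ≢ k) → 1 ≡ 𝟙 (d ≟ 1) + (𝟙 (d ≟ 2) + 𝟙 (d ≟ Δ))
      exactly-one d 1≤d excluded = by-cases (d ≟ 1) (d ≟ 2) (d ≟ Δ)
        where
        by-cases : Dec (d ≡ 1) → Dec (d ≡ 2) → Dec (d ≡ Δ) → 1 ≡ 𝟙 (d ≟ 1) + (𝟙 (d ≟ 2) + 𝟙 (d ≟ Δ))
        by-cases (yes refl) _ _ = refl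
        by-cases (no _) (yes refl) _ = refl
        by-cases (no _) (no _) (yes refl) = sym (𝟙-true (Δ ≟ Δ) refl)
        by-cases (no ≢1) (no ≢2) (no ≢Δ) = contradiction refl (excluded d ≢1 ≢2 ≢Δ 1≤d)
      one : ∀ v → 1 ≡ is 1 v + (is 2 v + is Δ v)
      one v = exactly-one (degree T v) (proj₁ (degree-bounds v))
        (λ k ≢1 ≢2 ≢Δ 1≤k → #vertices≡0 T (no-other-degree k ≢1 ≢2 ≢Δ 1≤k) v)

    -- Two expressions for n are compared: n₁ + 2n₂ + 2 from the edges and n₁ + n₂ + n_Δ from the
    -- vertices.
    n₂+2≡nᵟ : n₂ + 2 ≡ nᵟ
    n₂+2≡nᵟ = +-cancelˡ-≡ (n₁ + n₂) (n₂ + 2) nᵟ (begin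
      n₁ + n₂ + (n₂ + 2)   ≡⟨ rearrange n₁ n₂ ⟩
      n₁ + 2 * n₂ + 2      ≡⟨ cong₂ (λ s t → s + t + 2) m₁≡n₁ m₂≡2n₂ ⟨
      m₁ + m₂ + 2          ≡⟨ n≡m₁+m₂+2 ⟨
      n                    ≡⟨ n≡n₁+n₂+nᵟ ⟩
      n₁ + (n₂ + nᵟ)       ≡⟨ +-assoc n₁ n₂ nᵟ ⟨
      n₁ + n₂ + nᵟ         ∎)
      where
      open ≡-Reasoning
      rearrange : ∀ x y → x + y + (y + 2) ≡ x + 2 * y + 2
      rearrange = solve-∀

    -- The formula n₁ = (Δ - 2) n_Δ + 2 without subtraction. Writing one of the two copies of `nᵟ`
    -- as `n₂ + 2` completes the vertex total.
    n₁+2nᵟ≡Δnᵟ+2 : n₁ + 2 * nᵟ ≡ Δ * nᵟ + 2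
    n₁+2nᵟ≡Δnᵟ+2 = begin
      n₁ + 2 * nᵟ             ≡⟨ cong (λ k → n₁ + (k + (nᵟ + 0))) n₂+2≡nᵟ ⟨
      n₁ + (n₂ + 2 + (nᵟ + 0)) ≡⟨ rearrange n₁ n₂ nᵟ ⟩
      n₁ + (n₂ + nᵟ) + 2      ≡⟨ cong (_+ 2) n≡n₁+n₂+nᵟ ⟨
      n + 2                   ≡⟨ cong (_+ 2) Δnᵟ≡n ⟨
      Δ * nᵟ + 2              ∎
      where
      open ≡-Reasoning
      rearrange : ∀ x y z → x + (y + 2 + (z + 0)) ≡ x + (y + z) + 2
      rearrange = solve-∀

    n/Δ≡nᵟ : n / Δ ≡ nᵟ
    n/Δ≡nᵟ = trans (cong (_/ Δ) (trans (sym Δnᵟ≡n) (*-comm Δ nᵟ))) (m*n/n≡m nᵟ Δ)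

    counts : ExtremalCounts T Δ
    counts = record
      { n-Δ   = sym n/Δ≡nᵟ
      ; n-2   = begin
          ℤ.+ n₂                          ≡⟨ cancel₂ (ℤ.+ n₂) ⟩
          ℤ.+ (n₂ + 2) ℤ.- ℤ.+ 2          ≡⟨ cong (λ k → ℤ.+ k ℤ.- ℤ.+ 2) (trans n₂+2≡nᵟ (sym n/Δ≡nᵟ)) ⟩
          ℤ.+ (n / Δ) ℤ.- ℤ.+ 2           ∎
      ; n-1   = begin
          ℤ.+ n₁                                             ≡⟨ cancel₁ (ℤ.+ n₁) (ℤ.+ nᵟ) ⟩
          ℤ.+ n₁ ℤ.+ ℤ.+ 2 ℤ.* ℤ.+ nᵟ ℤ.- ℤ.+ 2 ℤ.* ℤ.+ nᵟ    ≡⟨ cong (λ k → ℤ.+ n₁ ℤ.+ k ℤ.- ℤ.+ 2 ℤ.* ℤ.+ nᵟ) (ℤ.pos-* 2 nᵟ) ⟨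
          ℤ.+ (n₁ + 2 * nᵟ) ℤ.- ℤ.+ 2 ℤ.* ℤ.+ nᵟ             ≡⟨ cong (λ k → ℤ.+ k ℤ.- ℤ.+ 2 ℤ.* ℤ.+ nᵟ) n₁+2nᵟ≡Δnᵟ+2 ⟩
          ℤ.+ (Δ * nᵟ) ℤ.+ ℤ.+ 2 ℤ.- ℤ.+ 2 ℤ.* ℤ.+ nᵟ        ≡⟨ cong (λ k → k ℤ.+ ℤ.+ 2 ℤ.- ℤ.+ 2 ℤ.* ℤ.+ nᵟ) (ℤ.pos-* Δ nᵟ) ⟩
          ℤ.+ Δ ℤ.* ℤ.+ nᵟ ℤ.+ ℤ.+ 2 ℤ.- ℤ.+ 2 ℤ.* ℤ.+ nᵟ    ≡⟨ factor (ℤ.+ Δ) (ℤ.+ nᵟ) ⟩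
          (ℤ.+ Δ ℤ.- ℤ.+ 2) ℤ.* ℤ.+ nᵟ ℤ.+ ℤ.+ 2             ≡⟨ cong (λ k → (ℤ.+ Δ ℤ.- ℤ.+ 2) ℤ.* ℤ.+ k ℤ.+ ℤ.+ 2) n/Δ≡nᵟ ⟨
          (ℤ.+ Δ ℤ.- ℤ.+ 2) ℤ.* ℤ.+ (n / Δ) ℤ.+ ℤ.+ 2        ∎
      ; m-1-Δ = m₁≡n₁
      ; m-2-Δ = m₂≡2n₂
      ; m-Δ-Δ = proj₁ c
      }
      where
      open ≡-Reasoning
      cancel₂ : ∀ x → x ≡ x ℤ.+ ℤ.+ 2 ℤ.- ℤ.+ 2
      cancel₂ = ℤ-Solver.solve-∀
      cancel₁ : ∀ x k → x ≡ x ℤ.+ ℤ.+ 2 ℤ.* k ℤ.- ℤ.+ 2 ℤ.* k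
      cancel₁ = ℤ-Solver.solve-∀
      factor : ∀ d k → d ℤ.* k ℤ.+ ℤ.+ 2 ℤ.- ℤ.+ 2 ℤ.* k ≡ (d ℤ.- ℤ.+ 2) ℤ.* k ℤ.+ ℤ.+ 2
      factor = ℤ-Solver.solve-∀

    extremal : Extremal T Δ
    extremal = record
      { m-Δ-Δ   = proj₁ c
      ; m-1-Δ   = subst (0 <_) (sym m₁≡n₁) n₁>0
      -- Without edges of type (2, Δ) there are no vertices of degree 2, so n_Δ = 2 and n = 2Δ.
      ; m-2-Δ   = λ n≢2Δ → n≢0⇒n>0 (λ m₂≡0 → n≢2Δ (begin-equality
          n          ≡⟨ Δnᵟ≡n ⟨
          Δ * nᵟ     ≡⟨ cong (Δ *_) n₂+2≡nᵟ ⟨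
          Δ * (n₂ + 2) ≡⟨ cong (λ k → Δ * (k + 2)) (m+n≡0⇒m≡0 n₂ (trans (sym m₂≡2n₂) m₂≡0)) ⟩
          Δ * 2      ≡⟨ *-comm Δ 2 ⟩
          2 * Δ      ∎))
      ; m-other = proj₂ c
      }
      where
      open ≤-Reasoning
      n₁>0 : 0 < n₁
      n₁>0 = +-cancelʳ-< (2 * nᵟ) 0 n₁ (begin-strict
        2 * nᵟ        ≤⟨ *-monoˡ-≤ nᵟ (m≤m+n 2 (2 + e)) ⟩
        Δ * nᵟ        <⟨ m<m+n (Δ * nᵟ) z<s ⟩
        Δ * nᵟ + 2    ≡⟨ n₁+2nᵟ≡Δnᵟ+2 ⟨
        n₁ + 2 * nᵟ   ∎)

theorem4p6 : (Δ n : ℕ) .{{_ : NonZero Δ}} → 4 ≤ Δ →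
    (T : Graph n) → IsTree T → HasMaxDegree T Δ → Δ ∣ n →
    (F Δ Δ Δ ℚ.≤ P T Δ)
    × ((P T Δ ≡ F Δ Δ Δ) ⇔ Extremal T Δ)
    × (P T Δ ≡ F Δ Δ Δ → ExtremalCounts T Δ)
theorem4p6 (suc (suc (suc (suc e)))) n (s≤s (s≤s (s≤s (s≤s z≤n)))) T tree maxDegree Δ∣n =
    P≥FΔΔ Δ∣n
  , mk⇔ (λ P≡ → Counts.extremal (equality⇒concentrated Δ∣n P≡))
        (λ ext → concentrated⇒equality (Extremal.m-Δ-Δ ext , Extremal.m-other ext))
  , λ P≡ → Counts.counts (equality⇒concentrated Δ∣n P≡)
  where open Bound e T tree maxDegree
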